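{- Let $n\ge 2$ and $1\le k\le n-1$. The adjacency spectrum of the enhanced hypercube $Q_{n,k}$ is \[\mathrm{Spec}_A(Q_{n,k})=\{n+1,\ [n-1]^{k-1},\ [n-2t-1]^{\gamma_t}\ (t=1,\dots,n-1),\ [-n-1]^{\gamma_n}\},\] where $\gamma_t=\sum_{j=0}^{n}{n-k+2\choose 2j}{k-1\choose t+1-2j}$ for $1\le t\le n-1$ and $\gamma_n=\sum_{j=1}^{n}{n-k+1\choose 2j-1}{k-1\choose n-2j+1}$.
   Context: For $n\ge 2$ and $1\le k\le n-1$, the enhanced hypercube $Q_{n,k}$ is the simple graph whose vertices are the binary strings $x_1x_2\cdots x_n$ ($x_i\in\{0,1\}$), where $X=x_1\cdots x_n$ and $Y$ are adjacent iff either $Y$ is obtained from $X$ by complementing exactly one coordinate ($1\le i\le n$), or $Y=x_1\cdots x_{k-1}\overline{x_k}\,\overline{x_{k+1}}\cdots\overline{x_n}$. The adjacency spectrum is the multiset of eigenvalues of the adjacency matrix; $[\lambda]^m$ denotes eigenvalue $\lambda$ with multiplicity $m$ (multiplicity $0$ meaning $\lambda$ does not occur). Binomial coefficients ${a\choose b}$ are $0$ when $b<0$ or $b>a$. -}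

module Defs where

open import Data.Bool using (Bool; true; false; not; if_then_else_; _∨_; _∧_)
open import Data.Nat as ℕ using (ℕ; zero; suc; _∸_; _≤ᵇ_; _≡ᵇ_)
open import Data.Nat.DivMod using (_/_; _%_)
open import Data.Nat.Combinatorics using (_C_)
open import Data.Integer as ℤ using (ℤ; +_; -[1+_])
open import Data.Fin using (Fin; toℕ; punchIn)
import Data.Fin as Fin
open import Data.Vec using (Vec; []; _∷_; lookup; tabulate)
open import Data.List using (List; []; _∷_; map)

-- Vertices of Q_{n,k}: binary strings x_1 … x_n, as Vec Bool n
-- (position i : Fin n is coordinate x_{toℕ i + 1}).

complFrom : ∀ {n} → ℕ → Vec Bool n → Vec Bool n
complFrom k x = tabulate λ i →
  if k ≤ᵇ suc (toℕ i) then not (lookup x i) else lookup x i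

hamming : ∀ {n} → Vec Bool n → Vec Bool n → ℕ
hamming []       []       = 0
hamming (a ∷ x) (b ∷ y) = (if (a ∧ not b) ∨ (not a ∧ b) then 1 else 0) ℕ.+ hamming x y

boolEq : Bool → Bool → Bool
boolEq a b = (a ∧ b) ∨ (not a ∧ not b)

vecEq : ∀ {n} → Vec Bool n → Vec Bool n → Bool
vecEq []       []       = true
vecEq (a ∷ x) (b ∷ y) = boolEq a b ∧ vecEq x y

adjQ : ∀ {n} → ℕ → Vec Bool n → Vec Bool n → Bool
adjQ k x y = (hamming x y ≡ᵇ 1) ∨ vecEq y (complFrom k x)

bits : ℕ → (n : ℕ) → Vec Bool n
bits m zero    = []
bits m (suc n) = (m % 2 ≡ᵇ 1) ∷ bits (m / 2) n

vertex : (n : ℕ) → Fin (2 ℕ.^ n) → Vec Bool n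
vertex n i = bits (toℕ i) n

adjMatrix : (n k : ℕ) → Fin (2 ℕ.^ n) → Fin (2 ℕ.^ n) → ℤ
adjMatrix n k i j = if adjQ k (vertex n i) (vertex n j) then + 1 else + 0

-- Polynomials over ℤ as coefficient lists (constant term first).

Poly : Set
Poly = List ℤ

infixl 6 _+P_
infixl 7 _*P_

_+P_ : Poly → Poly → Poly
[]      +P q       = q
(a ∷ p) +P []      = a ∷ p
(a ∷ p) +P (b ∷ q) = (a ℤ.+ b) ∷ (p +P q)

scaleP : ℤ → Poly → Poly
scaleP a p = map (a ℤ.*_) p

negP : Poly → Poly
negP = scaleP (ℤ.- (+ 1))

_*P_ : Poly → Poly → Poly
[]      *P q = []
(a ∷ p) *P q = scaleP a q +P (+ 0 ∷ (p *P q))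

constP : ℤ → Poly
constP a = a ∷ []

oneP : Poly
oneP = constP (+ 1)

varP : Poly
varP = + 0 ∷ + 1 ∷ []

_^P_ : Poly → ℕ → Poly
p ^P zero  = oneP
p ^P suc m = p *P (p ^P m)

coeff : Poly → ℕ → ℤ
coeff []      _       = + 0
coeff (a ∷ p) zero    = a
coeff (a ∷ p) (suc i) = coeff p i

infix 4 _≈P_
_≈P_ : Poly → Poly → Set
p ≈P q = ∀ i → coeff p i ≡ coeff q i
  where open import Relation.Binary.PropositionalEquality using (_≡_)

sumFin : ∀ {m} → (Fin m → Poly) → Poly
sumFin {zero}  f = []
sumFin {suc m} f = f Fin.zero +P sumFin (λ j → f (Fin.suc j))

signP : ℕ → Poly → Poly
signP j p = if j % 2 ≡ᵇ 0 then p else negP p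

det : ∀ {m} → (Fin m → Fin m → Poly) → Poly
det {zero}  M = oneP
det {suc m} M = sumFin λ j →
  signP (toℕ j) (M Fin.zero j *P det (λ r c → M (Fin.suc r) (punchIn j c)))

charPoly : ∀ {m} → (Fin m → Fin m → ℤ) → Poly
charPoly {m} A = det λ i j →
  (if toℕ i ≡ᵇ toℕ j then varP else []) +P negP (constP (A i j))

-- Spectrum as a multiset, encoded by ∏ (x - λ)^{mult}.

linP : ℤ → Poly
linP λ₀ = ℤ.- λ₀ ∷ + 1 ∷ []

binZ : ℕ → ℤ → ℕ
binZ a (+ b)    = a C b
binZ a -[1+ _ ] = 0

sumRange : ℕ → ℕ → (ℕ → ℕ) → ℕ
sumRange lo zero     f = if lo ≤ᵇ 0 then f 0 else 0
sumRange lo (suc hi) f = sumRange lo hi f ℕ.+ (if lo ≤ᵇ suc hi then f (suc hi) else 0)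

prodRange : ℕ → ℕ → (ℕ → Poly) → Poly
prodRange lo zero     f = if lo ≤ᵇ 0 then f 0 else oneP
prodRange lo (suc hi) f = prodRange lo hi f *P (if lo ≤ᵇ suc hi then f (suc hi) else oneP)

gamma : (n k t : ℕ) → ℕ
gamma n k t = sumRange 0 n λ j →
  ((n ∸ k ℕ.+ 2) C (2 ℕ.* j)) ℕ.* binZ (k ∸ 1) (+ (t ℕ.+ 1) ℤ.- + (2 ℕ.* j))

gammaN : (n k : ℕ) → ℕ
gammaN n k = sumRange 1 n λ j →
  ((n ∸ k ℕ.+ 1) C (2 ℕ.* j ∸ 1)) ℕ.* binZ (k ∸ 1) (+ (n ℕ.+ 1) ℤ.- + (2 ℕ.* j))

spectrumPoly : (n k : ℕ) → Poly
spectrumPoly n k =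
  linP (+ (n ℕ.+ 1))
  *P (linP (+ n ℤ.- + 1) ^P (k ∸ 1))
  *P prodRange 1 (n ∸ 1) (λ t → linP (+ n ℤ.- + (2 ℕ.* t) ℤ.- + 1) ^P gamma n k t)
  *P (linP (ℤ.- + (n ℕ.+ 1)) ^P gammaN n k)

{-# OPTIONS --safe #-}

-- Q_{n,k} is a Cayley graph of (ℤ/2)ⁿ, so the matrix H of characters (-1)^{x·z} diagonalises its
-- adjacency matrix A over ℤ: A H = H Λ and H H = 2ⁿ I. Taking determinants over ℤ[x] in
-- (x - A) H = H (x - Λ) and cancelling det H · det H, a nonzero constant, gives
-- det (x - A) = ∏_z (x - λ_z). The eigenvalue at z is λ_z = n - 2|z| + (-1)^b with b the weight of
-- z_k … z_n, that is n + 1 - 2s where s is the weight of z with a parity bit for z_k … z_n appended.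
-- Hence λ = n + 1 - 2s has multiplicity ∑_j C(n - k + 2, 2j) C(k - 1, s - 2j), by Pascal's rule.
module Submission where

open import Defs
open import Algebra.Bundles using (CommutativeMonoid; CommutativeRing)
open import Data.Bool using (Bool; true; false; not; if_then_else_; _∧_; _xor_)
open import Data.Fin as Fin using (Fin; zero; suc; toℕ; punchIn)
open import Data.Fin.Properties using (toℕ<n)
open import Data.Integer as ℤ using (ℤ; +_)
import Data.Integer.Properties as ℤₚ
open import Data.Integer.Tactic.RingSolver using (solve-∀)
open import Data.Nat as ℕ using (ℕ; zero; suc; z≤n; s≤s; _≤_; _∸_)
open import Data.Nat.Combinatorics using (_C_; nCk+nC[k+1]≡[n+1]C[k+1]; k>n⇒nCk≡0)
open import Data.Nat.DivMod as ℕ÷ using (_/_; _%_)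
import Data.Nat.Properties as ℕₚ
open import Data.Product using (_,_)
open import Data.Sum using (inj₁; inj₂)
open import Function using (_∘_)
open import Level using (_⊔_; 0ℓ)
open import Relation.Binary.Bundles using (Setoid)
import Algebra.Properties.CommutativeMonoid.Sum
import Algebra.Properties.CommutativeSemigroup
import Algebra.Properties.Ring
import Algebra.Properties.Semiring.Sum
import Relation.Binary.Reasoning.Setoid

-- Determinants over a commutative ring

-- The determinant of the statement is a bare recursive expansion along the first row, so much of
-- the work lies in its multiplicativity. This comes from uniqueness: a function of n rows of length
-- n that is linear in each row and vanishes at two equal rows is the determinant times its value at
-- the identity, and A ↦ det (A B) is such a function. That the determinant itself vanishes at two
-- equal rows cannot be read off the first row, hence the detour through the first column. Since H H
-- = 2ⁿ I, the square of det H is known although det H is never evaluated, and no fractions appear.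
-- The condition k ≤ n - 1 enters once: it makes the complemented block at least two coordinates
-- long. For a block of one coordinate the extra edge would be one of the ordinary edges, and the
-- adjacency matrix would no longer be the sum of the two parts that produce the eigenvalue.

module Determinant {c ℓ} (R : CommutativeRing c ℓ) where
  open import Data.Vec.Functional using (_∷_)
  open CommutativeRing R hiding (zero)
  open Algebra.Properties.Ring ring using (-‿distribˡ-*; -0#≈0#)
  open Algebra.Properties.Semiring.Sum semiring
  open Algebra.Properties.CommutativeMonoid.Sum *-commutativeMonoid using ()
    renaming (sum to product)
  open Algebra.Properties.CommutativeSemigroup *-commutativeSemigroup
    using (x∙yz≈y∙xz)
  open Relation.Binary.Reasoning.Setoid setoid

  Row : ℕ → Set c
  Row n = Fin n → Carrier

  Matrix : ℕ → ℕ → Set c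
  Matrix m n = Fin m → Row n

  infix 4 _≋_ _≋₂_

  _≋_ : ∀ {n} → Row n → Row n → Set ℓ
  u ≋ v = ∀ i → u i ≈ v i

  _≋₂_ : ∀ {m n} → Matrix m n → Matrix m n → Set ℓ
  A ≋₂ B = ∀ i → A i ≋ B i

  infixl 7 _·_ _⊗_

  _·_ : ∀ {m n} → Row m → Matrix m n → Row n
  (v · B) j = sum λ k → v k * B k j

  _⊗_ : ∀ {l m n} → Matrix l m → Matrix m n → Matrix l n
  (A ⊗ B) i = A i · B

  -- The test on `toℕ` is the one in `charPoly`, so both can be settled by the same case split, and
  -- shifting both indices by `suc` leaves the entry unchanged by computation.
  δ : ∀ {n} → Matrix n n
  δ i j = if toℕ i ℕ.≡ᵇ toℕ j then 1# else 0#

  sgn : ℕ → Carrier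
  sgn zero    = 1#
  sgn (suc n) = - sgn n

  minor : ∀ {m n} → Fin (suc m) → Fin (suc n) → Matrix (suc m) (suc n) → Matrix m n
  minor i j M r s = M (punchIn i r) (punchIn j s)

  determinant : ∀ {n} → Matrix n n → Carrier
  determinant {zero}  M = 1#
  determinant {suc n} M = sum λ j → sgn (toℕ j) * (M zero j * determinant (minor zero j M))

  ∷-cong : ∀ {m n} {u v : Row n} {A B : Matrix m n} → u ≋ v → A ≋₂ B → (u ∷ A) ≋₂ (v ∷ B)
  ∷-cong u≋v A≋B zero    = u≋v
  ∷-cong u≋v A≋B (suc i) = A≋B i

  -- Matrices are functions, so reassembling one from its rows gives only pointwise equality. This
  -- is why functions of matrices carry a proof that they respect `≋₂`.
  ∷-η : ∀ {m n} (A : Matrix (suc m) n) → A ≋₂ (A zero ∷ A ∘ suc)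
  ∷-η A zero    _ = refl
  ∷-η A (suc i) _ = refl

  det-cong : ∀ {n} {A B : Matrix n n} → A ≋₂ B → determinant A ≈ determinant B
  det-cong {zero}  A≋B = refl
  det-cong {suc n} A≋B = sum-cong-≋ λ j → *-congˡ {sgn (toℕ j)}
    (*-cong (A≋B zero j) (det-cong λ r s → A≋B (suc r) (punchIn j s)))

  sum-zero : ∀ {n} {f : Row n} → (∀ i → f i ≈ 0#) → sum f ≈ 0#
  sum-zero {n} f≈0 = trans (sum-cong-≋ f≈0) (sum-replicate-zero n)

  δ·-zero : ∀ {m} {i : Fin m} (v : Row m) → sum (λ k → δ i k * v k) ≈ v i
  δ·-zero {i = zero} v =
    trans (+-cong (*-identityˡ _) (sum-zero λ k → zeroˡ (v (suc k)))) (+-identityʳ _)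
  δ·-zero {i = suc i} v =
    trans (+-cong (zeroˡ _) (δ·-zero (v ∘ suc))) (+-identityˡ _)

  δ-sym : ∀ {m} (i j : Fin m) → δ i j ≈ δ j i
  δ-sym zero    zero    = refl
  δ-sym zero    (suc j) = refl
  δ-sym (suc i) zero    = refl
  δ-sym (suc i) (suc j) = δ-sym i j

  δ-⊗ : ∀ {m n} (B : Matrix m n) → δ ⊗ B ≋₂ B
  δ-⊗ B i j = δ·-zero (λ k → B k j)

  ·-δ : ∀ {n} (v : Row n) → v · δ ≋ v
  ·-δ v j = trans (sum-cong-≋ λ k → trans (*-comm (v k) (δ k j)) (*-congʳ (δ-sym k j)))
                  (δ·-zero v)

  ·-linear : ∀ {m n} a (u v : Row m) (B : Matrix m n) →
    (λ i → a * u i + v i) · B ≋ λ j → a * (u · B) j + (v · B) j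
  ·-linear a u v B j = begin
    sum (λ k → (a * u k + v k) * B k j)
      ≈⟨ sum-cong-≋ (λ k → trans (distribʳ _ _ _) (+-congʳ (*-assoc a (u k) (B k j)))) ⟩
    sum (λ k → a * (u k * B k j) + v k * B k j)
      ≈⟨ ∑-distrib-+ (λ k → a * (u k * B k j)) (λ k → v k * B k j) ⟩
    sum (λ k → a * (u k * B k j)) + (v · B) j
      ≈⟨ +-congʳ (sym (*-distribˡ-sum a (λ k → u k * B k j))) ⟩
    a * (u · B) j + (v · B) j ∎

  ·-cong : ∀ {m n} {u v : Row m} (B : Matrix m n) → u ≋ v → u · B ≋ v · B
  ·-cong B u≋v j = sum-cong-≋ λ k → *-congʳ {B k j} (u≋v k)

  -- Expanding the minors of the other entries of the first row along their first column gives a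
  -- double sum that is symmetric in rows and columns.
  det-first-column : ∀ {n} (M : Matrix (suc n) (suc n)) →
    determinant M ≈ sum λ i → sgn (toℕ i) * (M i zero * determinant (minor i zero M))
  det-first-column {zero}  M = refl
  det-first-column {suc n} M = +-congˡ (begin
    sum (λ j → - sgn (toℕ j) * (M zero (suc j) * determinant (minor zero (suc j) M)))
      ≈⟨ sum-cong-≋ (λ j → *-congˡ { - sgn (toℕ j)} (*-congˡ {M zero (suc j)}
           (det-first-column (minor zero (suc j) M)))) ⟩
    sum (λ j → - sgn (toℕ j) * (M zero (suc j) * sum λ i → inner i j))
      ≈⟨ sum-cong-≋ (λ j → trans (*-congˡ {p j} (*-distribˡ-sum (M zero (suc j)) (λ i → inner i j)))
           (*-distribˡ-sum (p j) (λ i → M zero (suc j) * inner i j))) ⟩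
    sum (λ j → sum λ i → - sgn (toℕ j) * (M zero (suc j) * inner i j))
      ≈⟨ ∑-comm (λ j i → - sgn (toℕ j) * (M zero (suc j) * inner i j)) ⟩
    sum (λ i → sum λ j → - sgn (toℕ j) * (M zero (suc j) * inner i j))
      ≈⟨ sum-cong-≋ (λ i → sum-cong-≋ λ j →
           exchange (sgn (toℕ j)) (M zero (suc j)) (sgn (toℕ i)) (M (suc i) zero) (rest i j)) ⟩
    sum (λ i → sum λ j → - sgn (toℕ i) * (M (suc i) zero * inner′ i j))
      ≈⟨ sum-cong-≋ (λ i → trans (*-congˡ {p i} (*-distribˡ-sum (M (suc i) zero) (inner′ i)))
           (*-distribˡ-sum (p i) (λ j → M (suc i) zero * inner′ i j))) ⟨
    sum (λ i → - sgn (toℕ i) * (M (suc i) zero * determinant (minor (suc i) zero M))) ∎)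
    where
    p : Row (suc n)
    p i = - sgn (toℕ i)
    rest inner inner′ : Matrix (suc n) (suc n)
    rest i j = determinant (λ r s → M (suc (punchIn i r)) (suc (punchIn j s)))
    inner i j = sgn (toℕ i) * (M (suc i) zero * rest i j)
    inner′ i j = sgn (toℕ j) * (M zero (suc j) * rest i j)

    exchange : ∀ s a t b d → - s * (a * (t * (b * d))) ≈ - t * (b * (s * (a * d)))
    exchange s a t b d = begin
      - s * (a * (t * (b * d)))   ≈⟨ *-congˡ (x∙yz≈y∙xz a t (b * d)) ⟩
      - s * (t * (a * (b * d)))   ≈⟨ -‿distribˡ-* s _ ⟨
      - (s * (t * (a * (b * d)))) ≈⟨ -‿cong (x∙yz≈y∙xz s t _) ⟩
      - (t * (s * (a * (b * d)))) ≈⟨ -‿cong (*-congˡ (*-congˡ (x∙yz≈y∙xz a b d))) ⟩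
      - (t * (s * (b * (a * d)))) ≈⟨ -‿cong (*-congˡ (x∙yz≈y∙xz s b _)) ⟩
      - (t * (b * (s * (a * d)))) ≈⟨ -‿distribˡ-* t _ ⟩
      - t * (b * (s * (a * d)))   ∎

  -- Alternating multilinear functions of the rows

  Congruent : ∀ {m n} → (Matrix m n → Carrier) → Set (c ⊔ ℓ)
  Congruent D = ∀ {A B} → A ≋₂ B → D A ≈ D B

  FirstRowLinear : ∀ {m n} → (Matrix (suc m) n → Carrier) → Set (c ⊔ ℓ)
  FirstRowLinear D = ∀ a u v A →
    D ((λ j → a * u j + v j) ∷ A) ≈ a * D (u ∷ A) + D (v ∷ A)

  -- Equality with the first row suffices in the last premise: other pairs of rows are covered by
  -- the recursive premise, which fixes the first row.
  data Alternating {n : ℕ} : (m : ℕ) → (Matrix m n → Carrier) → Set (c ⊔ ℓ) where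
    nullary : ∀ {D} → Congruent D → Alternating zero D
    step    : ∀ {m D} → Congruent D → FirstRowLinear D →
              (∀ v → Alternating m (λ A → D (v ∷ A))) →
              (∀ A r → A zero ≋ A (suc r) → D A ≈ 0#) →
              Alternating (suc m) D

  alt-cong : ∀ {m n} {D : Matrix m n → Carrier} → Alternating m D → Congruent D
  alt-cong (nullary cong)    = cong
  alt-cong (step cong _ _ _) = cong

  alt-resp : ∀ {m n} {D E : Matrix m n → Carrier} → (∀ A → D A ≈ E A) →
    Alternating m D → Alternating m E
  alt-resp {E = E} D≈E (nullary cong) =
    nullary λ {A} {B} A≋B → trans (sym (D≈E A)) (trans (cong A≋B) (D≈E B))
  alt-resp D≈E (step cong lin fix van) = step
    (λ {A} {B} A≋B → trans (sym (D≈E A)) (trans (cong A≋B) (D≈E B)))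
    (λ a u v A → trans (sym (D≈E _)) (trans (lin a u v A) (+-cong (*-congˡ (D≈E _)) (D≈E _))))
    (λ v → alt-resp (λ A → D≈E (v ∷ A)) (fix v))
    (λ A r eq → trans (sym (D≈E A)) (van A r eq))

  -- Right multiplication acts on each row separately and linearly, so every condition carries over.
  -- A rectangular `B` is allowed because `alt-unique` multiplies by a matrix with one row fewer
  -- than columns.
  alt-· : ∀ {m n n′} {D : Matrix m n → Carrier} (B : Matrix n′ n) →
    Alternating m D → Alternating m (λ A → D (A ⊗ B))
  alt-· B (nullary cong) = nullary λ A≋A′ → cong λ i → ·-cong B (A≋A′ i)
  alt-· {D = D} B (step cong lin fix van) = step
    (λ A≋A′ → cong λ i → ·-cong B (A≋A′ i))
    (λ a u v A → trans (cong (split (λ j → a * u j + v j) A)) (trans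
      (cong (∷-cong (·-linear a u v B) λ _ _ → refl))
      (trans (lin a (u · B) (v · B) (A ⊗ B))
        (sym (+-cong (*-congˡ (cong (split u A))) (cong (split v A)))))))
    (λ v → alt-resp (λ A → sym (cong (split v A))) (alt-· B (fix (v · B))))
    (λ A r eq → van (A ⊗ B) r (·-cong B eq))
    where
    split : ∀ {m} v (A : Matrix m _) → (v ∷ A) ⊗ B ≋₂ (v · B ∷ A ⊗ B)
    split v A zero    _ = refl
    split v A (suc i) _ = refl

  alt-minor : ∀ {m n} {D : Matrix m n → Carrier} (j : Fin (suc n)) →
    Alternating m D → Alternating m (λ A → D (λ r s → A r (punchIn j s)))
  alt-minor j (nullary cong) = nullary λ A≋A′ → cong λ i s → A≋A′ i (punchIn j s)
  alt-minor {D = D} j (step cong lin fix van) = step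
    (λ A≋A′ → cong λ i s → A≋A′ i (punchIn j s))
    (λ a u v A → trans (cong (split (λ j → a * u j + v j) A))
      (trans (lin a (u ∘ punchIn j) (v ∘ punchIn j) _)
        (sym (+-cong (*-congˡ (cong (split u A))) (cong (split v A))))))
    (λ v → alt-resp (λ A → sym (cong (split v A))) (alt-minor j (fix (v ∘ punchIn j))))
    (λ A r eq → van _ r (eq ∘ punchIn j))
    where
    split : ∀ {m} v (A : Matrix m _) →
      (λ r s → (v ∷ A) r (punchIn j s)) ≋₂ (v ∘ punchIn j ∷ λ r s → A r (punchIn j s))
    split v A zero    _ = refl
    split v A (suc i) _ = refl

  alt-∑ : ∀ {m n k} (a : Row k) (D : Fin k → Matrix m n → Carrier) →
    (∀ j → Alternating m (D j)) → Alternating m (λ A → sum λ j → a j * D j A)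
  alt-∑ {zero} a D alt = nullary λ A≋B → sum-cong-≋ λ j → *-congˡ {a j} (alt-cong (alt j) A≋B)
  alt-∑ {suc m} {n} a D alt = step
    (λ A≋B → sum-cong-≋ λ j → *-congˡ {a j} (alt-cong (alt j) A≋B))
    (λ b u v A → begin
      sum (λ j → a j * D j ((λ i → b * u i + v i) ∷ A))
        ≈⟨ sum-cong-≋ (λ j → trans (*-congˡ {a j} (linear (alt j) b u v A))
             (trans (distribˡ _ _ _) (+-congʳ (x∙yz≈y∙xz (a j) b _)))) ⟩
      sum (λ j → b * (a j * D j (u ∷ A)) + a j * D j (v ∷ A))
        ≈⟨ ∑-distrib-+ (λ j → b * (a j * D j (u ∷ A))) _ ⟩
      sum (λ j → b * (a j * D j (u ∷ A))) + sum (λ j → a j * D j (v ∷ A))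
        ≈⟨ +-congʳ (*-distribˡ-sum b (λ j → a j * D j (u ∷ A))) ⟨
      b * sum (λ j → a j * D j (u ∷ A)) + sum (λ j → a j * D j (v ∷ A)) ∎)
    (λ v → alt-∑ a (λ j A → D j (v ∷ A)) (λ j → fixed (alt j) v))
    (λ A r eq → sum-zero λ j → trans (*-congˡ (vanish (alt j) A r eq)) (zeroʳ (a j)))
    where
    linear : ∀ {D : Matrix (suc m) n → Carrier} → Alternating (suc m) D → FirstRowLinear D
    linear (step _ lin _ _) = lin
    fixed : ∀ {D : Matrix (suc m) n → Carrier} → Alternating (suc m) D → ∀ v → Alternating m (λ A → D (v ∷ A))
    fixed (step _ _ fix _) = fix
    vanish : ∀ {D : Matrix (suc m) n → Carrier} → Alternating (suc m) D → ∀ A r → A zero ≋ A (suc r) → D A ≈ 0#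
    vanish (step _ _ _ van) = van

  linear-zero : ∀ {m n} {D : Matrix (suc m) n → Carrier} → Congruent D → FirstRowLinear D →
    ∀ A → D ((λ _ → 0#) ∷ A) ≈ 0#
  linear-zero {D = D} cong lin A = begin
    D (z ∷ A)                        ≈⟨ cong (∷-cong (λ _ → sym zero′) λ _ _ → refl) ⟩
    -- The scalar -1 makes the two resulting terms cancel.
    D ((λ _ → - 1# * 0# + 0#) ∷ A)   ≈⟨ lin (- 1#) z z A ⟩
    - 1# * D (z ∷ A) + D (z ∷ A)     ≈⟨ +-congʳ (trans (sym (-‿distribˡ-* 1# _)) (-‿cong (*-identityˡ _))) ⟩
    - D (z ∷ A) + D (z ∷ A)          ≈⟨ -‿inverseˡ _ ⟩
    0#                               ∎
    where
    z : Row _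
    z _ = 0#
    zero′ : - 1# * 0# + 0# ≈ 0#
    zero′ = trans (+-identityʳ _) (zeroʳ (- 1#))

  linear-∑ : ∀ {m n k} {D : Matrix (suc m) n → Carrier} → Congruent D → FirstRowLinear D →
    ∀ (a : Row k) (B : Matrix k n) A → D (a · B ∷ A) ≈ sum λ i → a i * D (B i ∷ A)
  linear-∑ {k = zero}  cong lin a B A = linear-zero cong lin A
  linear-∑ {k = suc k} cong lin a B A =
    trans (lin (a zero) (B zero) ((a ∘ suc) · (B ∘ suc)) A)
      (+-congˡ (linear-∑ cong lin (a ∘ suc) (B ∘ suc) A))

  -- Polarisation: expand the zero value at the rows u + v, u + v. The conditions are listed
  -- separately instead of as `Alternating` because `det-vanishes` needs the sign change before the
  -- determinant is known to be alternating.
  swap₀₁ : ∀ {m n} {D : Matrix (suc (suc m)) n → Carrier} →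
    Congruent D → FirstRowLinear D → (∀ u → FirstRowLinear (λ A → D (u ∷ A))) →
    (∀ v A → D (v ∷ v ∷ A) ≈ 0#) → ∀ u v A → D (u ∷ v ∷ A) ≈ - D (v ∷ u ∷ A)
  swap₀₁ {D = D} cong lin lin′ van u v A = begin
    D (u ∷ v ∷ A)                                          ≈⟨ +-identityʳ _ ⟨
    D (u ∷ v ∷ A) + 0#                                     ≈⟨ +-congˡ (-‿inverseʳ _) ⟨
    D (u ∷ v ∷ A) + (D (v ∷ u ∷ A) + - D (v ∷ u ∷ A))      ≈⟨ +-assoc _ _ _ ⟨
    (D (u ∷ v ∷ A) + D (v ∷ u ∷ A)) + - D (v ∷ u ∷ A)      ≈⟨ +-congʳ total ⟨
    D (w ∷ w ∷ A) + - D (v ∷ u ∷ A)                        ≈⟨ +-congʳ (van w A) ⟩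
    0# + - D (v ∷ u ∷ A)                                   ≈⟨ +-identityˡ _ ⟩
    - D (v ∷ u ∷ A)                                        ∎
    where
    w : Row _
    w j = 1# * u j + v j
    half : ∀ x → D (x ∷ w ∷ A) ≈ D (x ∷ u ∷ A) + D (x ∷ v ∷ A)
    half x = trans (lin′ x 1# u v A) (+-congʳ (*-identityˡ _))
    total : D (w ∷ w ∷ A) ≈ D (u ∷ v ∷ A) + D (v ∷ u ∷ A)
    total = begin
      D (w ∷ w ∷ A)                        ≈⟨ lin 1# u v (w ∷ A) ⟩
      1# * D (u ∷ w ∷ A) + D (v ∷ w ∷ A)   ≈⟨ +-cong (trans (*-identityˡ _) (half u)) (half v) ⟩
      (D (u ∷ u ∷ A) + D (u ∷ v ∷ A)) + (D (v ∷ u ∷ A) + D (v ∷ v ∷ A))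
        ≈⟨ +-cong (trans (+-congʳ (van u A)) (+-identityˡ _)) (trans (+-congˡ (van v A)) (+-identityʳ _)) ⟩
      D (u ∷ v ∷ A) + D (v ∷ u ∷ A)        ∎

  -- By linearity the multiple of `e` splits off from one row at a time, and the split-off term has
  -- `e` as a row and is zero. With `e` the unit row above, this is column clearing.
  alt-clear : ∀ {m n} {F : Matrix m n → Carrier} → Alternating m F → (e : Row n) →
    (∀ A r → A r ≋ e → F A ≈ 0#) → ∀ (a : Row m) A →
    F (λ r j → a r * e j + A r j) ≈ F A
  alt-clear (nullary cong) e van a A = cong λ ()
  alt-clear {F = F} (step cong lin fix _) e van a A = begin
    F (λ r j → a r * e j + A r j)                      ≈⟨ cong (∷-η _) ⟩
    F ((λ j → a zero * e j + A zero j) ∷ A′)           ≈⟨ lin (a zero) e (A zero) A′ ⟩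
    a zero * F (e ∷ A′) + F (A zero ∷ A′)
      ≈⟨ +-congʳ (trans (*-congˡ (van (e ∷ A′) zero λ _ → refl)) (zeroʳ _)) ⟩
    0# + F (A zero ∷ A′)                               ≈⟨ +-identityˡ _ ⟩
    F (A zero ∷ A′)
      ≈⟨ alt-clear (fix (A zero)) e (λ B r → van (A zero ∷ B) (suc r)) (a ∘ suc) (A ∘ suc) ⟩
    F (A zero ∷ A ∘ suc)                               ≈⟨ cong (∷-η A) ⟨
    F A                                                ∎
    where
    A′ : Matrix _ _
    A′ r j = a (suc r) * e j + A (suc r) j

  -- Row j passes the j rows above it by one transposition each: the step exchanges it with the
  -- first row, and the recursion handles the rows below.
  alt-punchIn : ∀ {m n} {D : Matrix (suc m) n → Carrier} → Alternating (suc m) D →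
    ∀ j (B : Matrix (suc m) n) → D (B j ∷ B ∘ punchIn j) ≈ sgn (toℕ j) * D B
  alt-punchIn (step cong _ _ _) zero B =
    trans (cong λ i j → sym (∷-η B i j)) (sym (*-identityˡ _))
  alt-punchIn {suc m} {D = D} (step cong lin fix van) (suc j) B = begin
    D (B (suc j) ∷ B ∘ punchIn (suc j))
      ≈⟨ cong (∷-cong (λ _ → refl) (∷-η (B ∘ punchIn (suc j)))) ⟩
    D (B (suc j) ∷ B zero ∷ B ∘ suc ∘ punchIn j)
      ≈⟨ swap₀₁ cong lin lin′ (λ v A → van _ zero λ _ → refl) _ _ _ ⟩
    - D (B zero ∷ B (suc j) ∷ B ∘ suc ∘ punchIn j)
      ≈⟨ -‿cong (alt-punchIn (fix (B zero)) j (B ∘ suc)) ⟩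
    - (sgn (toℕ j) * D (B zero ∷ B ∘ suc))
      ≈⟨ -‿distribˡ-* _ _ ⟩
    - sgn (toℕ j) * D (B zero ∷ B ∘ suc)
      ≈⟨ *-congˡ (cong (∷-η B)) ⟨
    - sgn (toℕ j) * D B ∎
    where
    lin′ : ∀ u → FirstRowLinear (λ A → D (u ∷ A))
    lin′ u with fix u
    ... | step _ l _ _ = l

  -- Expand the first row in unit rows. When the first row is the unit row j, column j of the other
  -- rows can be cleared; what remains is an alternating function of the minor, to which the
  -- induction applies. The sign comes from returning the unit row to place j.
  alt-unique : ∀ {n} {D : Matrix n n → Carrier} → Alternating n D → ∀ A → D A ≈ determinant A * D δ
  alt-unique (nullary cong) A = trans (cong λ ()) (sym (*-identityˡ _))
  alt-unique {suc n} {D} alt@(step cong lin fix van) A = begin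
    D A
      ≈⟨ cong (∷-η A) ⟩
    D (A zero ∷ A ∘ suc)
      ≈⟨ cong (∷-cong (λ j → sym (·-δ (A zero) j)) λ _ _ → refl) ⟩
    D (A zero · δ ∷ A ∘ suc)
      ≈⟨ linear-∑ cong lin (A zero) δ (A ∘ suc) ⟩
    sum (λ j → A zero j * D (δ j ∷ A ∘ suc))
      ≈⟨ sum-cong-≋ (λ j → trans (*-congˡ {A zero j} (expand j)) (rearrange j)) ⟩
    sum (λ j → sgn (toℕ j) * (A zero j * determinant (minor zero j A)) * D δ)
      ≈⟨ *-distribʳ-sum (D δ) (λ j → sgn (toℕ j) * (A zero j * determinant (minor zero j A))) ⟨
    determinant A * D δ ∎
    where
    rearrange : ∀ j → A zero j * (determinant (minor zero j A) * (sgn (toℕ j) * D δ)) ≈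
      sgn (toℕ j) * (A zero j * determinant (minor zero j A)) * D δ
    rearrange j = begin
      a * (d * (s * x))  ≈⟨ *-congˡ (x∙yz≈y∙xz d s x) ⟩
      a * (s * (d * x))  ≈⟨ x∙yz≈y∙xz a s _ ⟩
      s * (a * (d * x))  ≈⟨ *-congˡ (*-assoc a d x) ⟨
      s * (a * d * x)    ≈⟨ *-assoc s (a * d) x ⟨
      s * (a * d) * x    ∎
      where
      a d s x : Carrier
      a = A zero j
      d = determinant (minor zero j A)
      s = sgn (toℕ j)
      x = D δ
    expand : ∀ j → D (δ j ∷ A ∘ suc) ≈ determinant (minor zero j A) * (sgn (toℕ j) * D δ)
    expand j = begin
      D (δ j ∷ A ∘ suc)
        ≈⟨ cong (∷-cong (λ _ → refl) decompose) ⟩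
      D (δ j ∷ λ r s → A (suc r) j * δ j s + (minor zero j A ⊗ E) r s)
        ≈⟨ alt-clear (fix (δ j)) (δ j) (λ B r eq → van (δ j ∷ B) r λ s → sym (eq s)) (λ r → A (suc r) j) _ ⟩
      D (δ j ∷ minor zero j A ⊗ E)
        ≈⟨ alt-unique (alt-· E (fix (δ j))) (minor zero j A) ⟩
      determinant (minor zero j A) * D (δ j ∷ δ ⊗ E)
        ≈⟨ *-congˡ (cong (∷-cong (λ _ → refl) (δ-⊗ E))) ⟩
      determinant (minor zero j A) * D (δ j ∷ E)
        ≈⟨ *-congˡ (alt-punchIn alt j δ) ⟩
      determinant (minor zero j A) * (sgn (toℕ j) * D δ) ∎
      where
      -- The unit rows other than row j: right multiplication by `E` inserts a zero column at place
      -- j into the minor.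
      E : Matrix n (suc n)
      E = δ ∘ punchIn j
      decompose : A ∘ suc ≋₂ λ r s → A (suc r) j * δ j s + (minor zero j A ⊗ E) r s
      decompose r s = trans (sym (·-δ (A (suc r)) s)) (sum-remove {i = j} (λ k → A (suc r) k * δ k s))

  -- Along the first column the first two terms have the same entry and the same minor but opposite
  -- signs. Every later minor still begins with two equal rows, so it vanishes by induction.
  det-rows₀₁ : ∀ {n} (M : Matrix (suc (suc n)) (suc (suc n))) → M zero ≋ M (suc zero) → determinant M ≈ 0#
  det-rows₀₁ M eq = begin
    determinant M
      ≈⟨ det-first-column M ⟩
    1# * (M zero zero * determinant (minor zero zero M)) +
      (- 1# * (M (suc zero) zero * determinant (minor (suc zero) zero M)) + later)
      ≈⟨ +-congˡ (+-cong (*-congˡ (*-cong (sym (eq zero)) (det-cong same))) (sum-zero others)) ⟩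
    1# * x + (- 1# * x + 0#)
      ≈⟨ +-cong (*-identityˡ x) (trans (+-identityʳ _)
           (trans (sym (-‿distribˡ-* 1# x)) (-‿cong (*-identityˡ x)))) ⟩
    x + - x
      ≈⟨ -‿inverseʳ x ⟩
    0# ∎
    where
    x later : Carrier
    x = M zero zero * determinant (minor zero zero M)
    term : Row _
    term i = sgn (toℕ (Fin.suc (Fin.suc i))) * (M (suc (suc i)) zero * determinant (minor (suc (suc i)) zero M))
    later = sum term
    same : minor (suc zero) zero M ≋₂ minor zero zero M
    same zero    s = eq (suc s)
    same (suc r) s = refl
    others : ∀ i → term i ≈ 0#
    -- Both clauses are the same; matching on the index only reveals that there is a third row, so
    -- that the minor has at least two.
    others i@zero = trans (*-congˡ (trans (*-congˡ
      (det-rows₀₁ (minor (suc (suc i)) zero M) (eq ∘ suc))) (zeroʳ _))) (zeroʳ _)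
    others i@(suc _) = trans (*-congˡ (trans (*-congˡ
      (det-rows₀₁ (minor (suc (suc i)) zero M) (eq ∘ suc))) (zeroʳ _))) (zeroʳ _)

  det-linear : ∀ {n} → FirstRowLinear (determinant {suc n})
  det-linear {n} a u v A = begin
    sum (λ j → sgn (toℕ j) * ((a * u j + v j) * d j))
      ≈⟨ sum-cong-≋ (λ j → trans
           (*-congˡ {sgn (toℕ j)} (trans (distribʳ (d j) (a * u j) (v j)) (+-congʳ (*-assoc a (u j) (d j)))))
           (trans (distribˡ (sgn (toℕ j)) _ _) (+-congʳ (x∙yz≈y∙xz (sgn (toℕ j)) a _)))) ⟩
    sum (λ j → a * (sgn (toℕ j) * (u j * d j)) + sgn (toℕ j) * (v j * d j))
      ≈⟨ ∑-distrib-+ (λ j → a * (sgn (toℕ j) * (u j * d j))) (λ j → sgn (toℕ j) * (v j * d j)) ⟩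
    sum (λ j → a * (sgn (toℕ j) * (u j * d j))) + determinant (v ∷ A)
      ≈⟨ +-congʳ (*-distribˡ-sum a (λ j → sgn (toℕ j) * (u j * d j))) ⟨
    a * determinant (u ∷ A) + determinant (v ∷ A) ∎
    where
    d : Row (suc n)
    d j = determinant (λ r s → A r (punchIn j s))

  -- If the equal row lies below the second, exchanging the first two rows moves the equal pair
  -- below the first row, where `fix` applies.
  det-vanishes : ∀ {n} → (∀ v → Alternating n (λ A → determinant (v ∷ A))) →
    ∀ (A : Matrix (suc n) (suc n)) r → A zero ≋ A (suc r) → determinant A ≈ 0#
  det-vanishes fix A zero eq = det-rows₀₁ A eq
  det-vanishes {suc n} fix A (suc r) eq = begin
    determinant A
      ≈⟨ det-cong {suc (suc n)} split ⟩
    determinant (A zero ∷ A (suc zero) ∷ A″)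
      ≈⟨ swap₀₁ det-cong det-linear linear (λ v B → det-rows₀₁ (v ∷ v ∷ B) λ _ → refl)
           (A zero) (A (suc zero)) A″ ⟩
    - determinant (A (suc zero) ∷ A zero ∷ A″)
      ≈⟨ -‿cong (vanish (A zero ∷ A″) r eq) ⟩
    - 0#
      ≈⟨ -0#≈0# ⟩
    0# ∎
    where
    A″ : Matrix n (suc (suc n))
    A″ i = A (suc (suc i))
    split : A ≋₂ (A zero ∷ A (suc zero) ∷ A″)
    split zero          _ = refl
    split (suc zero)    _ = refl
    split (suc (suc i)) _ = refl
    linear : ∀ u → FirstRowLinear (λ B → determinant (u ∷ B))
    linear u with fix u
    ... | step _ lin _ _ = lin
    vanish : ∀ B r → B zero ≋ B (suc r) → determinant (A (suc zero) ∷ B) ≈ 0#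
    vanish with fix (A (suc zero))
    ... | step _ _ _ van = van

  -- With the first row fixed, the expansion is a linear combination of determinants of the
  -- remaining rows with one column deleted, and these are alternating by induction.
  det-alternating : ∀ {n} → Alternating n (determinant {n})
  det-alternating {zero}  = nullary λ _ → refl
  det-alternating {suc n} = step det-cong det-linear fixed (det-vanishes fixed)
    where
    fixed : ∀ v → Alternating n (λ A → determinant (v ∷ A))
    fixed v = alt-resp (λ A → sum-cong-≋ λ j → *-assoc (sgn (toℕ j)) (v j) (determinant λ r s → A r (punchIn j s)))
      (alt-∑ (λ j → sgn (toℕ j) * v j) (λ j A → determinant λ r s → A r (punchIn j s))
        λ j → alt-minor j (det-alternating {n}))

  det-⊗ : ∀ {n} (A B : Matrix n n) → determinant (A ⊗ B) ≈ determinant A * determinant B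
  det-⊗ A B = trans (alt-unique (alt-· B det-alternating) A) (*-congˡ (det-cong (δ-⊗ B)))

  det-diagonal : ∀ {n} (d : Row n) → determinant (λ i j → δ i j * d j) ≈ product d
  det-diagonal {zero}  d = refl
  det-diagonal {suc n} d = begin
    1# * (1# * d zero * determinant (λ i j → δ i j * d (suc j))) +
      sum (λ j → s j * (0# * d (suc j) * rest j))
      ≈⟨ +-cong (*-identityˡ _) (sum-zero λ j → trans
           (*-congˡ {s j} (trans (*-congʳ (zeroˡ (d (suc j)))) (zeroˡ (rest j)))) (zeroʳ (s j))) ⟩
    1# * d zero * determinant (λ i j → δ i j * d (suc j)) + 0#
      ≈⟨ +-identityʳ _ ⟩
    1# * d zero * determinant (λ i j → δ i j * d (suc j))
      ≈⟨ *-cong (*-identityˡ _) (det-diagonal (d ∘ suc)) ⟩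
    d zero * product (d ∘ suc) ∎
    where
    s rest : Row n
    s j = sgn (suc (toℕ j))
    rest j = determinant (minor zero (suc j) λ i j → δ i j * d j)

  ·-diagonal : ∀ {n} (v d : Row n) → v · (λ k j → δ k j * d j) ≋ λ j → v j * d j
  ·-diagonal v d j = begin
    sum (λ k → v k * (δ k j * d j))   ≈⟨ sum-cong-≋ (λ k → *-assoc (v k) (δ k j) (d j)) ⟨
    sum (λ k → v k * δ k j * d j)     ≈⟨ *-distribʳ-sum (d j) (λ k → v k * δ k j) ⟨
    (v · δ) j * d j                   ≈⟨ *-congʳ (·-δ v j) ⟩
    v j * d j                         ∎

-- The ring ℤ[x]

open import Data.List using ([]; _∷_)
open import Data.Vec using (Vec; []; _∷_)
open import Relation.Binary.PropositionalEquality
  using (_≡_; refl; sym; trans; cong; cong₂; subst; module ≡-Reasoning)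

infix 4 _≋_

-- As a function type, _≈P_ does not determine its two arguments; the record does.
record _≋_ (p q : Poly) : Set where
  constructor coeffwise
  field
    coeff-≡ : p ≈P q

open _≋_

polySetoid : Setoid 0ℓ 0ℓ
polySetoid = record
  { Carrier = Poly
  ; _≈_ = _≋_
  ; isEquivalence = record
    { refl  = coeffwise λ _ → refl
    ; sym   = λ p≋q → coeffwise λ i → sym (coeff-≡ p≋q i)
    ; trans = λ p≋q q≋r → coeffwise λ i → trans (coeff-≡ p≋q i) (coeff-≡ q≋r i)
    }
  }

open Setoid polySetoid using () renaming (refl to ≋-refl; sym to ≋-sym; trans to ≋-trans)

∷-cong : ∀ {a b p q} → a ≡ b → p ≋ q → (a ∷ p) ≋ (b ∷ q)
∷-cong e f = coeffwise λ where
  zero    → e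
  (suc i) → coeff-≡ f i

coeff-+ : ∀ p q i → coeff (p +P q) i ≡ coeff p i ℤ.+ coeff q i
coeff-+ []      q       i       = sym (ℤₚ.+-identityˡ _)
coeff-+ (a ∷ p) []      i       = sym (ℤₚ.+-identityʳ _)
coeff-+ (a ∷ p) (b ∷ q) zero    = refl
coeff-+ (a ∷ p) (b ∷ q) (suc i) = coeff-+ p q i

coeff-scale : ∀ a p i → coeff (scaleP a p) i ≡ a ℤ.* coeff p i
coeff-scale a []      i       = sym (ℤₚ.*-zeroʳ a)
coeff-scale a (b ∷ p) zero    = refl
coeff-scale a (b ∷ p) (suc i) = coeff-scale a p i

+P-cong : ∀ {p p′ q q′} → p ≋ p′ → q ≋ q′ → p +P q ≋ p′ +P q′
+P-cong {p} {p′} {q} {q′} (coeffwise e) (coeffwise f) = coeffwise λ i → begin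
  coeff (p +P q) i            ≡⟨ coeff-+ p q i ⟩
  coeff p i ℤ.+ coeff q i     ≡⟨ cong₂ ℤ._+_ (e i) (f i) ⟩
  coeff p′ i ℤ.+ coeff q′ i   ≡⟨ coeff-+ p′ q′ i ⟨
  coeff (p′ +P q′) i          ∎
  where open ≡-Reasoning

+P-assoc : ∀ p q r → (p +P q) +P r ≋ p +P (q +P r)
+P-assoc []      q       r       = ≋-refl
+P-assoc (a ∷ p) []      r       = ≋-refl
+P-assoc (a ∷ p) (b ∷ q) []      = ≋-refl
+P-assoc (a ∷ p) (b ∷ q) (c ∷ r) = ∷-cong (ℤₚ.+-assoc a b c) (+P-assoc p q r)

+P-comm : ∀ p q → p +P q ≋ q +P p
+P-comm p q = coeffwise λ i → trans (coeff-+ p q i) (trans (ℤₚ.+-comm (coeff p i) _) (sym (coeff-+ q p i)))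

+P-identityʳ : ∀ p → p +P [] ≋ p
+P-identityʳ []      = ≋-refl
+P-identityʳ (a ∷ p) = ≋-refl

negP-inverseʳ : ∀ p → p +P negP p ≋ []
negP-inverseʳ p = coeffwise λ i → begin
  coeff (p +P negP p) i                              ≡⟨ coeff-+ p (negP p) i ⟩
  coeff p i ℤ.+ coeff (negP p) i                     ≡⟨ cong (λ x → coeff p i ℤ.+ x) (coeff-scale (ℤ.- + 1) p i) ⟩
  coeff p i ℤ.+ (ℤ.- + 1) ℤ.* coeff p i              ≡⟨ cancel (coeff p i) ⟩
  + 0                                                ∎
  where
  open ≡-Reasoning
  cancel : ∀ x → x ℤ.+ (ℤ.- + 1) ℤ.* x ≡ + 0
  cancel = solve-∀

scale-cong : ∀ {a b p q} → a ≡ b → p ≋ q → scaleP a p ≋ scaleP b q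
scale-cong {a} {b} {p} {q} e (coeffwise f) = coeffwise λ i →
  trans (coeff-scale a p i) (trans (cong₂ ℤ._*_ e (f i)) (sym (coeff-scale b q i)))

shift-zero : (+ 0 ∷ []) ≋ []
shift-zero = coeffwise λ where
  zero    → refl
  (suc i) → refl

*P-zeroʳ : ∀ p → p *P [] ≋ []
*P-zeroʳ []      = ≋-refl
*P-zeroʳ (a ∷ p) = ≋-trans (∷-cong refl (*P-zeroʳ p)) shift-zero

*P-congˡ : ∀ p {q q′} → q ≋ q′ → p *P q ≋ p *P q′
*P-congˡ []      e = ≋-refl
*P-congˡ (a ∷ p) {q} {q′} e = +P-cong {scaleP a q} {scaleP a q′}
  (scale-cong {a} refl e) (∷-cong refl (*P-congˡ p e))

module ≋-Reasoning = Relation.Binary.Reasoning.Setoid polySetoid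

scale-+ : ∀ a p q → scaleP a (p +P q) ≋ scaleP a p +P scaleP a q
scale-+ a []      q       = ≋-refl
scale-+ a (b ∷ p) []      = ≋-refl
scale-+ a (b ∷ p) (c ∷ q) = ∷-cong (ℤₚ.*-distribˡ-+ a b c) (scale-+ a p q)

scale-+ʳ : ∀ a b p → scaleP (a ℤ.+ b) p ≋ scaleP a p +P scaleP b p
scale-+ʳ a b []      = ≋-refl
scale-+ʳ a b (c ∷ p) = ∷-cong (ℤₚ.*-distribʳ-+ c a b) (scale-+ʳ a b p)

scale-scale : ∀ a b p → scaleP a (scaleP b p) ≋ scaleP (a ℤ.* b) p
scale-scale a b []      = ≋-refl
scale-scale a b (c ∷ p) = ∷-cong (sym (ℤₚ.*-assoc a b c)) (scale-scale a b p)

+P-interchange : ∀ p q r s → (p +P q) +P (r +P s) ≋ (p +P r) +P (q +P s)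
+P-interchange p q r s = coeffwise λ i → trans (four i p q r s)
  (trans (swap (coeff p i) (coeff q i) (coeff r i) (coeff s i)) (sym (four i p r q s)))
  where
  four : ∀ i p q r s → coeff ((p +P q) +P (r +P s)) i ≡
    (coeff p i ℤ.+ coeff q i) ℤ.+ (coeff r i ℤ.+ coeff s i)
  four i p q r s = trans (coeff-+ (p +P q) (r +P s) i) (cong₂ ℤ._+_ (coeff-+ p q i) (coeff-+ r s i))
  swap : ∀ a b c d → (a ℤ.+ b) ℤ.+ (c ℤ.+ d) ≡ (a ℤ.+ c) ℤ.+ (b ℤ.+ d)
  swap = solve-∀

*P-distribʳ : ∀ r p q → (p +P q) *P r ≋ p *P r +P q *P r
*P-distribʳ r []      q       = ≋-refl
*P-distribʳ r (a ∷ p) []      = ≋-sym (+P-identityʳ ((a ∷ p) *P r))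
*P-distribʳ r (a ∷ p) (b ∷ q) = begin
  scaleP (a ℤ.+ b) r +P (+ 0 ∷ (p +P q) *P r)
    ≈⟨ +P-cong (scale-+ʳ a b r) (∷-cong refl (*P-distribʳ r p q)) ⟩
  (scaleP a r +P scaleP b r) +P (+ 0 ∷ (p *P r +P q *P r))
    ≈⟨ +P-interchange (scaleP a r) (scaleP b r) (+ 0 ∷ p *P r) (+ 0 ∷ q *P r) ⟩
  (scaleP a r +P (+ 0 ∷ p *P r)) +P (scaleP b r +P (+ 0 ∷ q *P r)) ∎
  where open ≋-Reasoning

-- Multiplication recurses on its left factor; this is the mirrored recursion, from which
-- commutativity is immediate.
*P-shiftʳ : ∀ p b q → p *P (b ∷ q) ≋ scaleP b p +P (+ 0 ∷ p *P q)
*P-shiftʳ []      b q = ≋-sym shift-zero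
*P-shiftʳ (a ∷ p) b q = ∷-cong (cong (λ x → x ℤ.+ + 0) (ℤₚ.*-comm a b)) (begin
  scaleP a q +P p *P (b ∷ q)
    ≈⟨ +P-cong ≋-refl (*P-shiftʳ p b q) ⟩
  scaleP a q +P (scaleP b p +P (+ 0 ∷ p *P q))
    ≈⟨ +P-assoc (scaleP a q) (scaleP b p) _ ⟨
  (scaleP a q +P scaleP b p) +P (+ 0 ∷ p *P q)
    ≈⟨ +P-cong (+P-comm (scaleP a q) (scaleP b p)) ≋-refl ⟩
  (scaleP b p +P scaleP a q) +P (+ 0 ∷ p *P q)
    ≈⟨ +P-assoc (scaleP b p) (scaleP a q) _ ⟩
  scaleP b p +P (scaleP a q +P (+ 0 ∷ p *P q)) ∎)
  where open ≋-Reasoning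

*P-comm : ∀ p q → p *P q ≋ q *P p
*P-comm p []      = *P-zeroʳ p
*P-comm p (b ∷ q) = begin
  p *P (b ∷ q)                     ≈⟨ *P-shiftʳ p b q ⟩
  scaleP b p +P (+ 0 ∷ p *P q)     ≈⟨ +P-cong ≋-refl (∷-cong refl (*P-comm p q)) ⟩
  scaleP b p +P (+ 0 ∷ q *P p)     ∎
  where open ≋-Reasoning

-- Equal polynomials may be lists of different lengths, which obstructs recursion on the left
-- factor; commutativity moves the change to the right.
*P-cong : ∀ {p p′ q q′} → p ≋ p′ → q ≋ q′ → p *P q ≋ p′ *P q′
*P-cong {p} {p′} {q} {q′} e f = begin
  p *P q    ≈⟨ *P-congˡ p f ⟩
  p *P q′   ≈⟨ *P-comm p q′ ⟩
  q′ *P p   ≈⟨ *P-congˡ q′ e ⟩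
  q′ *P p′  ≈⟨ *P-comm q′ p′ ⟩
  p′ *P q′  ∎
  where open ≋-Reasoning

scale-*P : ∀ a p q → scaleP a p *P q ≋ scaleP a (p *P q)
scale-*P a []      q = ≋-refl
scale-*P a (b ∷ p) q = begin
  scaleP (a ℤ.* b) q +P (+ 0 ∷ scaleP a p *P q)
    ≈⟨ +P-cong (≋-sym (scale-scale a b q)) (∷-cong (sym (ℤₚ.*-zeroʳ a)) (scale-*P a p q)) ⟩
  scaleP a (scaleP b q) +P scaleP a (+ 0 ∷ p *P q)
    ≈⟨ scale-+ a (scaleP b q) _ ⟨
  scaleP a (scaleP b q +P (+ 0 ∷ p *P q)) ∎
  where open ≋-Reasoning

scale-zero : ∀ p → scaleP (+ 0) p ≋ []
scale-zero p = coeffwise λ i → trans (coeff-scale (+ 0) p i) (ℤₚ.*-zeroˡ (coeff p i))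

scale-one : ∀ p → scaleP (+ 1) p ≋ p
scale-one p = coeffwise λ i → trans (coeff-scale (+ 1) p i) (ℤₚ.*-identityˡ (coeff p i))

*P-assoc : ∀ p q r → (p *P q) *P r ≋ p *P (q *P r)
*P-assoc []      q r = ≋-refl
*P-assoc (a ∷ p) q r = begin
  (scaleP a q +P (+ 0 ∷ p *P q)) *P r
    ≈⟨ *P-distribʳ r (scaleP a q) (+ 0 ∷ p *P q) ⟩
  scaleP a q *P r +P (scaleP (+ 0) r +P (+ 0 ∷ (p *P q) *P r))
    ≈⟨ +P-cong (scale-*P a q r)
         (+P-cong (scale-zero r) (∷-cong refl (*P-assoc p q r))) ⟩
  scaleP a (q *P r) +P (+ 0 ∷ p *P (q *P r)) ∎
  where open ≋-Reasoning

*P-identityˡ : ∀ p → oneP *P p ≋ p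
*P-identityˡ p = begin
  scaleP (+ 1) p +P (+ 0 ∷ [])  ≈⟨ +P-cong (scale-one p) shift-zero ⟩
  p +P []                       ≈⟨ +P-identityʳ p ⟩
  p                             ∎
  where open ≋-Reasoning

*P-distribˡ : ∀ r p q → r *P (p +P q) ≋ r *P p +P r *P q
*P-distribˡ r p q = begin
  r *P (p +P q)        ≈⟨ *P-comm r (p +P q) ⟩
  (p +P q) *P r        ≈⟨ *P-distribʳ r p q ⟩
  p *P r +P q *P r     ≈⟨ +P-cong (*P-comm p r) (*P-comm q r) ⟩
  r *P p +P r *P q     ∎
  where open ≋-Reasoning

polyRing : CommutativeRing 0ℓ 0ℓ
polyRing = record
  { Carrier = Poly
  ; _≈_ = _≋_
  ; _+_ = _+P_
  ; _*_ = _*P_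
  ; -_ = negP
  ; 0# = []
  ; 1# = oneP
  ; isCommutativeRing = record
    { isRing = record
      { +-isAbelianGroup = record
        { isGroup = record
          { isMonoid = record
            { isSemigroup = record
              { isMagma = record
                { isEquivalence = Setoid.isEquivalence polySetoid
                ; ∙-cong = +P-cong
                }
              ; assoc = +P-assoc
              }
            ; identity = (λ _ → ≋-refl) , +P-identityʳ
            }
          ; inverse = (λ p → ≋-trans (+P-comm (negP p) p) (negP-inverseʳ p)) , negP-inverseʳ
          ; ⁻¹-cong = scale-cong {ℤ.- + 1} refl
          }
        ; comm = +P-comm
        }
      ; *-cong = *P-cong
      ; *-assoc = *P-assoc
      ; *-identity = *P-identityˡ , λ p → ≋-trans (*P-comm p oneP) (*P-identityˡ p)
      ; distrib = *P-distribˡ , *P-distribʳ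
      }
    ; *-comm = *P-comm
    }
  }

-- Characteristic polynomials of diagonalised matrices

module ℤM = Determinant ℤₚ.+-*-commutativeRing
module PM = Determinant polyRing
module ℤ∑ = Algebra.Properties.Semiring.Sum (CommutativeRing.semiring ℤₚ.+-*-commutativeRing)
module P∑ = Algebra.Properties.Semiring.Sum (CommutativeRing.semiring polyRing)
module P∏ = Algebra.Properties.CommutativeMonoid.Sum (CommutativeRing.*-commutativeMonoid polyRing)

open CommutativeRing polyRing
  using (+-cong; *-cong; *-congˡ; *-congʳ; zeroʳ; *-identityˡ; *-identityʳ; *-assoc; *-comm; -‿cong)
  renaming (reflexive to ≋-reflexive)
open Algebra.Properties.Ring (CommutativeRing.ring polyRing) using (-‿involutive; -‿distribˡ-*)

sumFin-cong : ∀ {m} {f g : Fin m → Poly} → (∀ i → f i ≋ g i) → sumFin f ≋ P∑.sum g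
sumFin-cong {zero}  f≋g = ≋-refl
sumFin-cong {suc m} f≋g = +-cong (f≋g Fin.zero) (sumFin-cong (f≋g ∘ Fin.suc))

signP-sgn : ∀ j p → signP j p ≋ PM.sgn j *P p
signP-sgn zero          p = ≋-sym (*-identityˡ p)
signP-sgn (suc zero)    p = ≋-sym (≋-trans (≋-sym (-‿distribˡ-* oneP p)) (-‿cong (*-identityˡ p)))
-- The parity of `suc (suc j)` reduces to that of `j` by computation.
signP-sgn (suc (suc j)) p = ≋-trans (signP-sgn j p) (*-congʳ (≋-sym (-‿involutive (PM.sgn j))))

det-≋ : ∀ {m} {M N : Fin m → Fin m → Poly} → (∀ i j → M i j ≋ N i j) → det M ≋ PM.determinant N
det-≋ {zero}  M≋N = ≋-refl
det-≋ {suc m} M≋N = sumFin-cong λ j → ≋-trans (signP-sgn (toℕ j) _)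
  (*-congˡ {PM.sgn (toℕ j)} (*-cong (M≋N Fin.zero j) (det-≋ λ r s → M≋N (Fin.suc r) (Fin.punchIn j s))))

constP-* : ∀ a b → constP a *P constP b ≋ constP (a ℤ.* b)
constP-* a b = ∷-cong (ℤₚ.+-identityʳ _) ≋-refl

constP-sum : ∀ {m} (f : Fin m → ℤ) → P∑.sum (constP ∘ f) ≋ constP (ℤ∑.sum f)
constP-sum {zero}  f = ≋-sym shift-zero
constP-sum {suc m} f = +-cong {constP (f Fin.zero)} ≋-refl (constP-sum (f ∘ Fin.suc))

constP-· : ∀ {m n} (v : ℤM.Row m) (B : ℤM.Matrix m n) j →
  ((constP ∘ v) PM.· λ k l → constP (B k l)) j ≋ constP ((v ℤM.· B) j)
constP-· v B j = ≋-trans (P∑.sum-cong-≋ λ k → constP-* (v k) (B k j)) (constP-sum λ k → v k ℤ.* B k j)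

constP-cancel : ∀ c .{{_ : ℤ.NonZero c}} {p q} → p *P constP c ≋ q *P constP c → p ≋ q
constP-cancel c {p} {q} e = coeffwise λ i →
  ℤₚ.*-cancelˡ-≡ c (coeff p i) (coeff q i)
    (trans (sym (times p i)) (trans (_≋_.coeff-≡ e i) (times q i)))
  where
  times : ∀ p i → coeff (p *P constP c) i ≡ c ℤ.* coeff p i
  times p i = trans (_≋_.coeff-≡ (≋-trans (*-comm p (constP c)) (≋-trans
    (+-cong {scaleP c p} ≋-refl shift-zero) (+P-identityʳ _))) i) (coeff-scale c p i)

-- The constant arrives from `det-diagonal` as an m-fold product; removing one factor at a time
-- requires only cancellation of a nonzero integer.
constP-power-cancel : ∀ m c .{{_ : ℤ.NonZero c}} {p q} →
  p *P P∏.sum {m} (λ _ → constP c) ≋ q *P P∏.sum {m} (λ _ → constP c) → p ≋ q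
constP-power-cancel zero    c {p} {q} e =
  ≋-trans (≋-sym (*-identityʳ p)) (≋-trans e (*-identityʳ q))
constP-power-cancel (suc m) c {p} {q} e = constP-cancel c (constP-power-cancel m c
  (≋-trans (*-assoc p (constP c) _) (≋-trans e (≋-sym (*-assoc q (constP c) _)))))

-- One entry of (x - A) H = H (x - Λ). Writing the diagonal as `varP *P PM.δ i k` puts each row of x
-- - A into the form that `·-linear` splits.
charMatrix-· : ∀ {m} (A H : ℤM.Matrix m m) (ev : ℤM.Row m) →
  A ℤM.⊗ H ℤM.≋₂ (λ i j → H i j ℤ.* ev j) → ∀ i j →
  ((λ k → (varP *P PM.δ i k) +P negP (constP (A i k))) PM.· λ k l → constP (H k l)) j
    ≋ constP (H i j) *P linP (ev j)
charMatrix-· A H ev AH i j = begin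
  ((λ k → (varP *P PM.δ i k) +P negP (constP (A i k))) PM.· H′) j
    ≈⟨ PM.·-linear varP (PM.δ i) (λ k → negP (constP (A i k))) H′ j ⟩
  varP *P (PM.δ i PM.· H′) j +P ((λ k → negP (constP (A i k))) PM.· H′) j
    ≈⟨ +-cong (*-congˡ {varP} (PM.δ-⊗ H′ i j)) (constP-· (λ k → ℤ.- + 1 ℤ.* A i k) H j) ⟩
  varP *P H′ i j +P constP (((λ k → ℤ.- + 1 ℤ.* A i k) ℤM.· H) j)
    ≡⟨ cong (λ a → varP *P H′ i j +P constP a) negated ⟩
  varP *P H′ i j +P constP (ℤ.- + 1 ℤ.* (H i j ℤ.* ev j))
    ≈⟨ ∷-cong (constant (H i j) (ev j)) (∷-cong (linear (H i j)) ≋-refl) ⟩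
  H′ i j *P linP (ev j) ∎
  where
  open ≋-Reasoning
  H′ : PM.Matrix _ _
  H′ k l = constP (H k l)
  negated : ((λ k → ℤ.- + 1 ℤ.* A i k) ℤM.· H) j ≡ ℤ.- + 1 ℤ.* (H i j ℤ.* ev j)
  negated = trans (ℤ∑.sum-cong-≋ λ k → ℤₚ.*-assoc (ℤ.- + 1) (A i k) (H k j))
    (trans (sym (ℤ∑.*-distribˡ-sum (ℤ.- + 1) λ k → A i k ℤ.* H k j)) (cong (λ x → ℤ.- + 1 ℤ.* x) (AH i j)))
  constant : ∀ h e → + 0 ℤ.* h ℤ.+ + 0 ℤ.+ (ℤ.- + 1) ℤ.* (h ℤ.* e) ≡ h ℤ.* (ℤ.- e) ℤ.+ + 0
  constant = solve-∀
  linear : ∀ h → + 1 ℤ.* h ℤ.+ + 0 ≡ h ℤ.* + 1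
  linear = solve-∀

charPoly-diagonalisable : ∀ {m} (A H : ℤM.Matrix m m) (ev : ℤM.Row m) c .{{_ : ℤ.NonZero c}} →
  A ℤM.⊗ H ℤM.≋₂ (λ i j → H i j ℤ.* ev j) →
  H ℤM.⊗ H ℤM.≋₂ (λ i j → ℤM.δ i j ℤ.* c) →
  charPoly A ≋ P∏.sum (linP ∘ ev)
charPoly-diagonalisable {m} A H ev c AH HH = constP-power-cancel m c (begin
  charPoly A *P C            ≈⟨ *-cong (det-≋ entry) (≋-sym hh) ⟩
  N *P (h *P h)              ≈⟨ *-assoc N h h ⟨
  N *P h *P h                ≈⟨ *-congʳ nh ⟩
  h *P Λ *P h                ≈⟨ *-congʳ (*-comm h Λ) ⟩
  Λ *P h *P h                ≈⟨ *-assoc Λ h h ⟩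
  Λ *P (h *P h)              ≈⟨ *-congˡ {Λ} hh ⟩
  Λ *P C                     ∎)
  where
  open ≋-Reasoning
  H′ charMatrix : PM.Matrix m m
  H′ k l = constP (H k l)
  charMatrix i k = varP *P PM.δ i k +P negP (constP (A i k))
  N h C Λ : Poly
  N = PM.determinant charMatrix
  h = PM.determinant H′
  C = P∏.sum {m} (λ _ → constP c)
  Λ = P∏.sum (linP ∘ ev)

  entry : ∀ i j → (if toℕ i ℕ.≡ᵇ toℕ j then varP else []) +P negP (constP (A i j)) ≋ charMatrix i j
  entry i j with toℕ i ℕ.≡ᵇ toℕ j
  ... | true  = +-cong {varP} (≋-sym (*-identityʳ varP)) (≋-refl {negP (constP (A i j))})
  ... | false = +-cong (≋-sym (zeroʳ varP)) (≋-refl {negP (constP (A i j))})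

  nh : N *P h ≋ h *P Λ
  nh = begin
    N *P h
      ≈⟨ PM.det-⊗ charMatrix H′ ⟨
    PM.determinant (charMatrix PM.⊗ H′)
      ≈⟨ PM.det-cong (λ i j → ≋-trans (charMatrix-· A H ev AH i j)
           (≋-sym (PM.·-diagonal (H′ i) (linP ∘ ev) j))) ⟩
    PM.determinant (H′ PM.⊗ λ k j → PM.δ k j *P linP (ev j))
      ≈⟨ PM.det-⊗ H′ _ ⟩
    h *P PM.determinant (λ k j → PM.δ k j *P linP (ev j))
      ≈⟨ *-congˡ {h} (PM.det-diagonal (linP ∘ ev)) ⟩
    h *P Λ ∎

  δ-const : ∀ i j → constP (ℤM.δ i j ℤ.* c) ≋ PM.δ {m} i j *P constP c
  δ-const i j with toℕ i ℕ.≡ᵇ toℕ j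
  ... | true  = ≋-sym (constP-* (+ 1) c)
  ... | false = ≋-trans (∷-cong (ℤₚ.*-zeroˡ c) ≋-refl) shift-zero

  hh : h *P h ≋ C
  hh = begin
    h *P h
      ≈⟨ PM.det-⊗ H′ H′ ⟨
    PM.determinant (H′ PM.⊗ H′)
      ≈⟨ PM.det-cong (λ i j → ≋-trans (constP-· (H i) H j)
           (≋-trans (∷-cong (HH i j) ≋-refl) (δ-const i j))) ⟩
    PM.determinant {m} (λ i j → PM.δ i j *P constP c)
      ≈⟨ PM.det-diagonal {m} (λ _ → constP c) ⟩
    C ∎

-- Characters of the cube

half-suc : ∀ m → suc (suc m) / 2 ≡ suc (m / 2)
half-suc m = ℕ÷.m/n≡1+[m∸n]/n {suc (suc m)} {2} (s≤s (s≤s z≤n))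

bits-even : ∀ m n → bits (m ℕ.* 2) (suc n) ≡ false ∷ bits m n
bits-even m n = cong₂ (λ r q → (r ℕ.≡ᵇ 1) ∷ bits q n) (ℕ÷.m*n%n≡0 m 2) (ℕ÷.m*n/n≡m m 2)

bits-odd : ∀ m n → bits (suc (m ℕ.* 2)) (suc n) ≡ true ∷ bits m n
bits-odd m n = cong₂ (λ r q → (r ℕ.≡ᵇ 1) ∷ bits q n) (ℕ÷.[m+kn]%n≡m%n 1 m 2) (quotient m)
  where
  quotient : ∀ m → suc (m ℕ.* 2) / 2 ≡ m
  quotient zero    = refl
  quotient (suc m) = trans (half-suc (suc (m ℕ.* 2))) (cong suc (quotient m))

-- One fold serves three monoids: integer sums of characters, products of linear factors, and the
-- counting of strings.
module CubeFold {c ℓ} (M : CommutativeMonoid c ℓ) where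
  open CommutativeMonoid M renaming (refl to ≈-refl; trans to ≈-trans; sym to ≈-sym; reflexive to ≈-reflexive)
  open Algebra.Properties.CommutativeMonoid.Sum M using (sum)
  open Algebra.Properties.CommutativeSemigroup commutativeSemigroup using (interchange)

  foldCube : ∀ n → (Vec Bool n → Carrier) → Carrier
  foldCube zero    f = f []
  -- The head of a string is the lowest binary digit, so the strings paired here are those with
  -- consecutive indices 2m and 2m + 1.
  foldCube (suc n) f = foldCube n (λ x → f (false ∷ x) ∙ f (true ∷ x))

  foldCube-cong : ∀ n {f g : Vec Bool n → Carrier} → (∀ x → f x ≈ g x) → foldCube n f ≈ foldCube n g
  foldCube-cong zero    f≈g = f≈g []
  foldCube-cong (suc n) f≈g = foldCube-cong n λ x → ∙-cong (f≈g (false ∷ x)) (f≈g (true ∷ x))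

  foldCube-∙ : ∀ n (f g : Vec Bool n → Carrier) →
    foldCube n (λ x → f x ∙ g x) ≈ foldCube n f ∙ foldCube n g
  foldCube-∙ zero    f g = ≈-refl
  foldCube-∙ (suc n) f g = ≈-trans
    (foldCube-cong n λ x → interchange (f (false ∷ x)) (g (false ∷ x)) (f (true ∷ x)) (g (true ∷ x)))
    (foldCube-∙ n _ _)

  private
    -- Indexing by plain numbers lets the length 2 · 2ⁿ be rewritten as 2ⁿ · 2 without transporting
    -- indices in `Fin`.
    foldRange : ℕ → (ℕ → Carrier) → Carrier
    foldRange zero    g = ε
    foldRange (suc n) g = g 0 ∙ foldRange n (g ∘ suc)

    foldRange-sum : ∀ n g → sum {n} (g ∘ toℕ) ≡ foldRange n g
    foldRange-sum zero    g = refl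
    foldRange-sum (suc n) g = cong (g 0 ∙_) (foldRange-sum n (g ∘ suc))

    foldRange-cong : ∀ n {f g : ℕ → Carrier} → (∀ i → f i ≈ g i) → foldRange n f ≈ foldRange n g
    foldRange-cong zero    f≈g = ≈-refl
    foldRange-cong (suc n) f≈g = ∙-cong (f≈g 0) (foldRange-cong n (f≈g ∘ suc))

    foldRange-pairs : ∀ n g →
      foldRange (n ℕ.* 2) g ≈ foldRange n (λ m → g (m ℕ.* 2) ∙ g (suc (m ℕ.* 2)))
    foldRange-pairs zero    g = ≈-refl
    foldRange-pairs (suc n) g = ≈-trans (≈-sym (assoc _ _ _))
      (∙-congˡ (foldRange-pairs n (λ m → g (suc (suc m)))))

    foldRange-bits : ∀ n (f : Vec Bool n → Carrier) →
      foldRange (2 ℕ.^ n) (λ m → f (bits m n)) ≈ foldCube n f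
    foldRange-bits zero    f = identityʳ _
    foldRange-bits (suc n) f = ≈-trans
      (≈-reflexive (cong (λ N → foldRange N (λ m → f (bits m (suc n)))) (ℕₚ.*-comm 2 (2 ℕ.^ n))))
      (≈-trans (foldRange-pairs (2 ℕ.^ n) _)
      (≈-trans (foldRange-cong (2 ℕ.^ n) λ m →
          ≈-reflexive (cong₂ (λ x y → f x ∙ f y) (bits-even m n) (bits-odd m n)))
        (foldRange-bits n _)))

  sum-vertex : ∀ n (f : Vec Bool n → Carrier) → sum (f ∘ vertex n) ≈ foldCube n f
  sum-vertex n f = ≈-trans (≈-reflexive (foldRange-sum (2 ℕ.^ n) (λ m → f (bits m n)))) (foldRange-bits n f)

-- A number is determined by its parity and its half. In the mixed cases the halves already differ,
-- and the split on the parity only makes the conjunction compute.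
boolEq-parity-half : ∀ p q →
  boolEq (p % 2 ℕ.≡ᵇ 1) (q % 2 ℕ.≡ᵇ 1) ∧ (p / 2 ℕ.≡ᵇ q / 2) ≡ (p ℕ.≡ᵇ q)
boolEq-parity-half zero          zero          = refl
boolEq-parity-half zero          (suc zero)    = refl
boolEq-parity-half (suc zero)    zero          = refl
boolEq-parity-half (suc zero)    (suc zero)    = refl
boolEq-parity-half zero          (suc (suc q)) rewrite half-suc q with q % 2 ℕ.≡ᵇ 1
... | true  = refl
... | false = refl
boolEq-parity-half (suc zero)    (suc (suc q)) rewrite half-suc q with q % 2 ℕ.≡ᵇ 1
... | true  = refl
... | false = refl
boolEq-parity-half (suc (suc p)) zero          rewrite half-suc p with p % 2 ℕ.≡ᵇ 1
... | true  = refl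
... | false = refl
boolEq-parity-half (suc (suc p)) (suc zero)    rewrite half-suc p with p % 2 ℕ.≡ᵇ 1
... | true  = refl
... | false = refl
boolEq-parity-half (suc (suc p)) (suc (suc q)) rewrite half-suc p | half-suc q = boolEq-parity-half p q

vecEq-bits : ∀ n {p q} → p ℕ.< 2 ℕ.^ n → q ℕ.< 2 ℕ.^ n → vecEq (bits p n) (bits q n) ≡ (p ℕ.≡ᵇ q)
vecEq-bits zero    (s≤s z≤n) (s≤s z≤n) = refl
vecEq-bits (suc n) {p} {q} p< q< = trans
  (cong (boolEq (p % 2 ℕ.≡ᵇ 1) (q % 2 ℕ.≡ᵇ 1) ∧_) (vecEq-bits n (half< p<) (half< q<)))
  (boolEq-parity-half p q)
  where
  half< : ∀ {m} → m ℕ.< 2 ℕ.* 2 ℕ.^ n → m / 2 ℕ.< 2 ℕ.^ n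
  half< {m} m< = ℕ÷.m<n*o⇒m/o<n {m} {2 ℕ.^ n} {2} (subst (m ℕ.<_) (ℕₚ.*-comm 2 (2 ℕ.^ n)) m<)

vecEq-vertex : ∀ n (i j : Fin (2 ℕ.^ n)) → vecEq (vertex n i) (vertex n j) ≡ (toℕ i ℕ.≡ᵇ toℕ j)
vecEq-vertex n i j = vecEq-bits n (toℕ<n i) (toℕ<n j)

module ℤ□ = CubeFold (CommutativeRing.+-commutativeMonoid ℤₚ.+-*-commutativeRing)
open ℤ□ using () renaming (foldCube to ∑□; foldCube-cong to ∑□-cong; foldCube-∙ to ∑□-+)

∑□-* : ∀ n a (f : Vec Bool n → ℤ) → ∑□ n (λ x → a ℤ.* f x) ≡ a ℤ.* ∑□ n f
∑□-* zero    a f = refl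
∑□-* (suc n) a f = trans
  (∑□-cong n λ x → sym (ℤₚ.*-distribˡ-+ a (f (false ∷ x)) (f (true ∷ x))))
  (∑□-* n a _)

-- Orthogonality of the characters and the action of the adjacency matrix

σ : Bool → ℤ
σ b = if b then ℤ.- + 1 else + 1

-- Unfolds to the conditional in `adjMatrix`, whose entries are therefore values of `ι` by
-- computation.
ι : Bool → ℤ
ι b = if b then + 1 else + 0

χ : ∀ {n} → Vec Bool n → Vec Bool n → ℤ
χ []      []      = + 1
χ (a ∷ x) (b ∷ z) = σ (a ∧ b) ℤ.* χ x z

-- Each coordinate of y contributes the factor 1 + (-1)^(a + c), which is 2 if x and z agree there
-- and 0 otherwise.
χ-orthogonal : ∀ n (x z : Vec Bool n) →
  ∑□ n (λ y → χ x y ℤ.* χ y z) ≡ ι (vecEq x z) ℤ.* + (2 ℕ.^ n)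
χ-orthogonal zero    []      []      = refl
χ-orthogonal (suc n) (a ∷ x) (c ∷ z) = begin
  ∑□ n (λ y → σ (a ∧ false) ℤ.* χ x y ℤ.* (+ 1 ℤ.* χ y z) ℤ.+ σ (a ∧ true) ℤ.* χ x y ℤ.* (σ c ℤ.* χ y z))
    ≡⟨ ∑□-cong n (λ y → pair a c (χ x y) (χ y z)) ⟩
  ∑□ n (λ y → ι (boolEq a c) ℤ.* + 2 ℤ.* (χ x y ℤ.* χ y z))
    ≡⟨ ∑□-* n (ι (boolEq a c) ℤ.* + 2) (λ y → χ x y ℤ.* χ y z) ⟩
  ι (boolEq a c) ℤ.* + 2 ℤ.* ∑□ n (λ y → χ x y ℤ.* χ y z)
    ≡⟨ cong (λ s → ι (boolEq a c) ℤ.* + 2 ℤ.* s) (χ-orthogonal n x z) ⟩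
  ι (boolEq a c) ℤ.* + 2 ℤ.* (ι (vecEq x z) ℤ.* + (2 ℕ.^ n))
    ≡⟨ collect (boolEq a c) (vecEq x z) ⟩
  ι (boolEq a c ∧ vecEq x z) ℤ.* + (2 ℕ.* 2 ℕ.^ n) ∎
  where
  open ≡-Reasoning
  pair : ∀ a c u v → σ (a ∧ false) ℤ.* u ℤ.* (+ 1 ℤ.* v) ℤ.+ σ (a ∧ true) ℤ.* u ℤ.* (σ c ℤ.* v) ≡
    ι (boolEq a c) ℤ.* + 2 ℤ.* (u ℤ.* v)
  pair false false = equal
    where
    equal : ∀ u v → + 1 ℤ.* u ℤ.* (+ 1 ℤ.* v) ℤ.+ + 1 ℤ.* u ℤ.* (+ 1 ℤ.* v) ≡ + 1 ℤ.* + 2 ℤ.* (u ℤ.* v)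
    equal = solve-∀
  pair true true = equal
    where
    equal : ∀ u v → + 1 ℤ.* u ℤ.* (+ 1 ℤ.* v) ℤ.+ ℤ.- + 1 ℤ.* u ℤ.* (ℤ.- + 1 ℤ.* v) ≡ + 1 ℤ.* + 2 ℤ.* (u ℤ.* v)
    equal = solve-∀
  pair false true = distinct
    where
    distinct : ∀ u v → + 1 ℤ.* u ℤ.* (+ 1 ℤ.* v) ℤ.+ + 1 ℤ.* u ℤ.* (ℤ.- + 1 ℤ.* v) ≡ + 0 ℤ.* + 2 ℤ.* (u ℤ.* v)
    distinct = solve-∀
  pair true false = distinct
    where
    distinct : ∀ u v → + 1 ℤ.* u ℤ.* (+ 1 ℤ.* v) ℤ.+ ℤ.- + 1 ℤ.* u ℤ.* (+ 1 ℤ.* v) ≡ + 0 ℤ.* + 2 ℤ.* (u ℤ.* v)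
    distinct = solve-∀
  collect : ∀ b c → ι b ℤ.* + 2 ℤ.* (ι c ℤ.* + (2 ℕ.^ n)) ≡ ι (b ∧ c) ℤ.* + (2 ℕ.* 2 ℕ.^ n)
  collect b c = trans (factor b c (+ (2 ℕ.^ n)))
    (cong (λ N → ι (b ∧ c) ℤ.* N) (sym (ℤₚ.pos-* 2 (2 ℕ.^ n))))
    where
    factor : ∀ b c N → ι b ℤ.* + 2 ℤ.* (ι c ℤ.* N) ≡ ι (b ∧ c) ℤ.* (+ 2 ℤ.* N)
    factor false c N = refl
    factor true  c N = move (ι c) N
      where
      move : ∀ i N → + 1 ℤ.* + 2 ℤ.* (i ℤ.* N) ≡ i ℤ.* (+ 2 ℤ.* N)
      move = solve-∀

∑□-vecEq : ∀ n (w : Vec Bool n) (g : Vec Bool n → ℤ) → ∑□ n (λ y → ι (vecEq y w) ℤ.* g y) ≡ g w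
∑□-vecEq zero    []      g = ℤₚ.*-identityˡ (g [])
∑□-vecEq (suc n) (false ∷ w) g =
  trans (∑□-cong n λ y → ℤₚ.+-identityʳ _) (∑□-vecEq n w (g ∘ (false ∷_)))
∑□-vecEq (suc n) (true ∷ w) g =
  trans (∑□-cong n λ y → ℤₚ.+-identityˡ _) (∑□-vecEq n w (g ∘ (true ∷_)))

hamming-zero : ∀ {n} (x y : Vec Bool n) → (hamming x y ℕ.≡ᵇ 0) ≡ vecEq y x
hamming-zero []          []          = refl
hamming-zero (false ∷ x) (false ∷ y) = hamming-zero x y
hamming-zero (false ∷ x) (true ∷ y)  = refl
hamming-zero (true ∷ x)  (false ∷ y) = refl
hamming-zero (true ∷ x)  (true ∷ y)  = hamming-zero x y

signSum : ∀ {n} → Vec Bool n → ℤ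
signSum []      = + 0
signSum (b ∷ z) = σ b ℤ.+ signSum z

-- A neighbour either keeps the first coordinate and is a neighbour in the rest, or flips it and
-- agrees with x in the rest. The second case adds one sign to `signSum`.
∑□-neighbours : ∀ n (x z : Vec Bool n) →
  ∑□ n (λ y → ι (hamming x y ℕ.≡ᵇ 1) ℤ.* χ y z) ≡ χ x z ℤ.* signSum z
∑□-neighbours zero    []      []      = refl
∑□-neighbours (suc n) (a ∷ x) (b ∷ z) = begin
  ∑□ n (λ y → ι (hamming (a ∷ x) (false ∷ y) ℕ.≡ᵇ 1) ℤ.* (+ 1 ℤ.* χ y z) ℤ.+
              ι (hamming (a ∷ x) (true ∷ y) ℕ.≡ᵇ 1) ℤ.* (σ b ℤ.* χ y z))
    ≡⟨ ∑□-cong n (λ y → pair a y) ⟩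
  ∑□ n (λ y → σ (a ∧ b) ℤ.* (ι (hamming x y ℕ.≡ᵇ 1) ℤ.* χ y z) ℤ.+
              σ (not a ∧ b) ℤ.* (ι (vecEq y x) ℤ.* χ y z))
    ≡⟨ ∑□-+ n (λ y → σ (a ∧ b) ℤ.* (ι (hamming x y ℕ.≡ᵇ 1) ℤ.* χ y z)) _ ⟩
  ∑□ n (λ y → σ (a ∧ b) ℤ.* (ι (hamming x y ℕ.≡ᵇ 1) ℤ.* χ y z)) ℤ.+
  ∑□ n (λ y → σ (not a ∧ b) ℤ.* (ι (vecEq y x) ℤ.* χ y z))
    ≡⟨ cong₂ ℤ._+_ (∑□-* n (σ (a ∧ b)) _) (∑□-* n (σ (not a ∧ b)) _) ⟩
  σ (a ∧ b) ℤ.* ∑□ n (λ y → ι (hamming x y ℕ.≡ᵇ 1) ℤ.* χ y z) ℤ.+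
  σ (not a ∧ b) ℤ.* ∑□ n (λ y → ι (vecEq y x) ℤ.* χ y z)
    ≡⟨ cong₂ (λ s t → σ (a ∧ b) ℤ.* s ℤ.+ σ (not a ∧ b) ℤ.* t) (∑□-neighbours n x z) (∑□-vecEq n x (λ y → χ y z)) ⟩
  σ (a ∧ b) ℤ.* (χ x z ℤ.* signSum z) ℤ.+ σ (not a ∧ b) ℤ.* χ x z
    ≡⟨ collect a b (χ x z) (signSum z) ⟩
  σ (a ∧ b) ℤ.* χ x z ℤ.* (σ b ℤ.+ signSum z) ∎
  where
  open ≡-Reasoning
  pair : ∀ a y → ι (hamming (a ∷ x) (false ∷ y) ℕ.≡ᵇ 1) ℤ.* (+ 1 ℤ.* χ y z) ℤ.+
                 ι (hamming (a ∷ x) (true ∷ y) ℕ.≡ᵇ 1) ℤ.* (σ b ℤ.* χ y z) ≡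
    σ (a ∧ b) ℤ.* (ι (hamming x y ℕ.≡ᵇ 1) ℤ.* χ y z) ℤ.+ σ (not a ∧ b) ℤ.* (ι (vecEq y x) ℤ.* χ y z)
  pair false y rewrite hamming-zero x y = move (ι (hamming x y ℕ.≡ᵇ 1)) (ι (vecEq y x)) (χ y z) (σ b)
    where
    move : ∀ h e c s → h ℤ.* (+ 1 ℤ.* c) ℤ.+ e ℤ.* (s ℤ.* c) ≡ + 1 ℤ.* (h ℤ.* c) ℤ.+ s ℤ.* (e ℤ.* c)
    move = solve-∀
  pair true y rewrite hamming-zero x y = move (ι (hamming x y ℕ.≡ᵇ 1)) (ι (vecEq y x)) (χ y z) (σ b)
    where
    move : ∀ h e c s → e ℤ.* (+ 1 ℤ.* c) ℤ.+ h ℤ.* (s ℤ.* c) ≡ s ℤ.* (h ℤ.* c) ℤ.+ + 1 ℤ.* (e ℤ.* c)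
    move = solve-∀
  collect : ∀ a b c s → σ (a ∧ b) ℤ.* (c ℤ.* s) ℤ.+ σ (not a ∧ b) ℤ.* c ≡ σ (a ∧ b) ℤ.* c ℤ.* (σ b ℤ.+ s)
  collect false b c s = identity (σ b) c s
    where
    identity : ∀ u c s → + 1 ℤ.* (c ℤ.* s) ℤ.+ u ℤ.* c ≡ + 1 ℤ.* c ℤ.* (u ℤ.+ s)
    identity = solve-∀
  collect true false c s = identity c s
    where
    identity : ∀ c s → + 1 ℤ.* (c ℤ.* s) ℤ.+ + 1 ℤ.* c ≡ + 1 ℤ.* c ℤ.* (+ 1 ℤ.+ s)
    identity = solve-∀
  collect true true c s = identity c s
    where
    identity : ∀ c s → ℤ.- + 1 ℤ.* (c ℤ.* s) ℤ.+ + 1 ℤ.* c ≡ ℤ.- + 1 ℤ.* c ℤ.* (ℤ.- + 1 ℤ.+ s)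
    identity = solve-∀

-- The coordinates are counted from 0: skipping k of them leaves x_{k+1}, …, x_n.
oddAfter : ∀ {n} → ℕ → Vec Bool n → Bool
oddAfter k       []      = false
oddAfter zero    (b ∷ z) = b xor oddAfter zero z
oddAfter (suc k) (b ∷ z) = oddAfter k z

σ-xor : ∀ a b → σ (a xor b) ≡ σ a ℤ.* σ b
σ-xor false false = refl
σ-xor false true  = refl
σ-xor true  false = refl
σ-xor true  true  = refl

-- Every flipped coordinate contributes the sign of the corresponding bit of z. The shift from `k`
-- to `suc k` is that from counting coordinates from 0 to counting them from 1.
χ-complFrom : ∀ {n} k (x z : Vec Bool n) → χ (complFrom (suc k) x) z ≡ χ x z ℤ.* σ (oddAfter k z)
χ-complFrom k       []      []      = refl
χ-complFrom zero    (a ∷ x) (b ∷ z)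
  rewrite χ-complFrom zero x z | σ-xor b (oddAfter zero z) = flip a b (χ x z) (σ (oddAfter zero z))
  where
  flip : ∀ a b c s → σ (not a ∧ b) ℤ.* (c ℤ.* s) ≡ σ (a ∧ b) ℤ.* c ℤ.* (σ b ℤ.* s)
  flip false b c s = identity (σ b) c s
    where
    identity : ∀ u c s → u ℤ.* (c ℤ.* s) ≡ + 1 ℤ.* c ℤ.* (u ℤ.* s)
    identity = solve-∀
  flip true false c s = identity c s
    where
    identity : ∀ c s → + 1 ℤ.* (c ℤ.* s) ≡ + 1 ℤ.* c ℤ.* (+ 1 ℤ.* s)
    identity = solve-∀
  flip true true c s = identity c s
    where
    identity : ∀ c s → + 1 ℤ.* (c ℤ.* s) ≡ ℤ.- + 1 ℤ.* c ℤ.* (ℤ.- + 1 ℤ.* s)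
    identity = solve-∀
χ-complFrom (suc k) (a ∷ x) (b ∷ z)
  rewrite χ-complFrom k x z = sym (ℤₚ.*-assoc (σ (a ∧ b)) (χ x z) (σ (oddAfter k z)))

hamming-complFrom : ∀ {n} k (x : Vec Bool n) → hamming x (complFrom (suc k) x) ≡ n ℕ.∸ k
hamming-complFrom zero    []      = refl
hamming-complFrom (suc k) []      = refl
hamming-complFrom zero    (false ∷ x) = cong suc (hamming-complFrom zero x)
hamming-complFrom zero    (true ∷ x)  = cong suc (hamming-complFrom zero x)
hamming-complFrom (suc k) (false ∷ x) = hamming-complFrom k x
hamming-complFrom (suc k) (true ∷ x)  = hamming-complFrom k x

vecEq-sound : ∀ {n} (x y : Vec Bool n) → vecEq x y ≡ true → x ≡ y
vecEq-sound []          []          eq = refl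
vecEq-sound (false ∷ x) (false ∷ y) eq = cong (false ∷_) (vecEq-sound x y eq)
vecEq-sound (true ∷ x)  (true ∷ y)  eq = cong (true ∷_) (vecEq-sound x y eq)

-- The block has m + 2 coordinates, so complementing it moves x by distance at least 2. The two
-- kinds of edges are thus disjoint, and the disjunction becomes a sum.
ι-adjQ : ∀ k m (x y : Vec Bool (k ℕ.+ suc (suc m))) →
  ι (adjQ (suc k) x y) ≡ ι (hamming x y ℕ.≡ᵇ 1) ℤ.+ ι (vecEq y (complFrom (suc k) x))
ι-adjQ k m x y with vecEq y (complFrom (suc k) x) in eq
... | false with hamming x y ℕ.≡ᵇ 1
...   | true  = refl
...   | false = refl
ι-adjQ k m x y | true
  rewrite vecEq-sound y (complFrom (suc k) x) eq | hamming-complFrom k x | ℕₚ.m+n∸m≡n k (suc (suc m)) = refl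

eigenvalue : ∀ {n} → ℕ → Vec Bool n → ℤ
eigenvalue k z = signSum z ℤ.+ σ (oddAfter k z)

∑□-adjQ : ∀ k m (x z : Vec Bool (k ℕ.+ suc (suc m))) →
  ∑□ (k ℕ.+ suc (suc m)) (λ y → ι (adjQ (suc k) x y) ℤ.* χ y z) ≡ χ x z ℤ.* eigenvalue k z
∑□-adjQ k m x z = begin
  ∑□ n (λ y → ι (adjQ (suc k) x y) ℤ.* χ y z)
    ≡⟨ ∑□-cong n (λ y → trans (cong (λ i → i ℤ.* χ y z) (ι-adjQ k m x y))
         (ℤₚ.*-distribʳ-+ (χ y z) (ι (hamming x y ℕ.≡ᵇ 1)) (ι (vecEq y (complFrom (suc k) x))))) ⟩
  ∑□ n (λ y → ι (hamming x y ℕ.≡ᵇ 1) ℤ.* χ y z ℤ.+ ι (vecEq y (complFrom (suc k) x)) ℤ.* χ y z)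
    ≡⟨ ∑□-+ n _ _ ⟩
  ∑□ n (λ y → ι (hamming x y ℕ.≡ᵇ 1) ℤ.* χ y z) ℤ.+ ∑□ n (λ y → ι (vecEq y (complFrom (suc k) x)) ℤ.* χ y z)
    ≡⟨ cong₂ ℤ._+_ (∑□-neighbours n x z)
         (trans (∑□-vecEq n (complFrom (suc k) x) (λ y → χ y z)) (χ-complFrom k x z)) ⟩
  χ x z ℤ.* signSum z ℤ.+ χ x z ℤ.* σ (oddAfter k z)
    ≡⟨ ℤₚ.*-distribˡ-+ (χ x z) (signSum z) (σ (oddAfter k z)) ⟨
  χ x z ℤ.* eigenvalue k z ∎
  where
  open ≡-Reasoning
  n : ℕ
  n = k ℕ.+ suc (suc m)

module P□ = CubeFold (CommutativeRing.*-commutativeMonoid polyRing)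

charPoly-adjMatrix : ∀ k m → charPoly (adjMatrix (k ℕ.+ suc (suc m)) (suc k)) ≋
  P□.foldCube (k ℕ.+ suc (suc m)) (linP ∘ eigenvalue k)
charPoly-adjMatrix k m = ≋-trans
  (charPoly-diagonalisable (adjMatrix n (suc k)) H (eigenvalue k ∘ vertex n) (+ (2 ℕ.^ n)) {{nz}} AH HH)
  (P□.sum-vertex n (linP ∘ eigenvalue k))
  where
  n : ℕ
  n = k ℕ.+ suc (suc m)
  nz : ℤ.NonZero (+ (2 ℕ.^ n))
  nz = ℕₚ.m^n≢0 2 n
  H : ℤM.Matrix (2 ℕ.^ n) (2 ℕ.^ n)
  H i j = χ (vertex n i) (vertex n j)
  AH : adjMatrix n (suc k) ℤM.⊗ H ℤM.≋₂ (λ i j → H i j ℤ.* eigenvalue k (vertex n j))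
  AH i j = trans (ℤ□.sum-vertex n (λ y → ι (adjQ (suc k) (vertex n i) y) ℤ.* χ y (vertex n j)))
    (∑□-adjQ k m (vertex n i) (vertex n j))
  HH : H ℤM.⊗ H ℤM.≋₂ (λ i j → ℤM.δ i j ℤ.* + (2 ℕ.^ n))
  HH i j = trans (ℤ□.sum-vertex n (λ y → χ (vertex n i) y ℤ.* χ y (vertex n j)))
    (trans (χ-orthogonal n (vertex n i) (vertex n j))
      (cong (λ b → ι b ℤ.* + (2 ℕ.^ n)) (vecEq-vertex n i j)))

-- Multiplicities of the eigenvalues

module ℕ□ = CubeFold ℕₚ.+-0-commutativeMonoid
open ℕ□ using () renaming (foldCube to #□; foldCube-cong to #□-cong; foldCube-∙ to #□-+)
open import Data.Nat using (_+_; _*_; _<_; _≡ᵇ_)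

weight : ∀ {n} → Vec Bool n → ℕ
weight []      = 0
weight (b ∷ z) = (if b then 1 else 0) + weight z

-- For p = false the eigenvalue at z is n + 1 - 2 (level p k z). The other parity makes the
-- recursion over the complemented block close up.
level : ∀ {n} → Bool → ℕ → Vec Bool n → ℕ
level p k z = weight z + (if p xor oddAfter k z then 1 else 0)

signSum-weight : ∀ {n} (z : Vec Bool n) → signSum z ≡ + n ℤ.- + (2 * weight z)
signSum-weight []      = refl
signSum-weight {suc n} (false ∷ z) = trans (cong (λ s → + 1 ℤ.+ s) (signSum-weight z))
  (sym (ℤₚ.+-assoc (+ 1) (+ n) (ℤ.- + (2 * weight z))))
signSum-weight {suc n} (true ∷ z)  = begin
  ℤ.- + 1 ℤ.+ signSum z                             ≡⟨ cong (λ s → ℤ.- + 1 ℤ.+ s) (signSum-weight z) ⟩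
  ℤ.- + 1 ℤ.+ (+ n ℤ.- + (2 * w))                   ≡⟨ cong (λ s → ℤ.- + 1 ℤ.+ (+ n ℤ.- s)) (ℤₚ.pos-* 2 w) ⟩
  ℤ.- + 1 ℤ.+ (+ n ℤ.- + 2 ℤ.* + w)                 ≡⟨ identity (+ n) (+ w) ⟩
  (+ 1 ℤ.+ + n) ℤ.- + 2 ℤ.* (+ 1 ℤ.+ + w)           ≡⟨ cong (λ s → + suc n ℤ.- s) (ℤₚ.pos-* 2 (suc w)) ⟨
  + suc n ℤ.- + (2 * suc w)                         ∎
  where
  open ≡-Reasoning
  w : ℕ
  w = weight z
  identity : ∀ n w → ℤ.- + 1 ℤ.+ (n ℤ.- + 2 ℤ.* w) ≡ (+ 1 ℤ.+ n) ℤ.- + 2 ℤ.* (+ 1 ℤ.+ w)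
  identity = solve-∀

levelPoly : ℕ → ℕ → Poly
levelPoly n s = linP (+ suc n ℤ.- + (2 * s))

eigenvalue-level : ∀ {n} k (z : Vec Bool n) → eigenvalue k z ≡ + suc n ℤ.- + (2 * level false k z)
eigenvalue-level {n} k z = begin
  signSum z ℤ.+ σ o                       ≡⟨ cong (λ s → s ℤ.+ σ o) (signSum-weight z) ⟩
  + n ℤ.- + (2 * w) ℤ.+ σ o               ≡⟨ cong (λ s → + n ℤ.- s ℤ.+ σ o) (ℤₚ.pos-* 2 w) ⟩
  + n ℤ.- + 2 ℤ.* + w ℤ.+ σ o             ≡⟨ identity o (+ n) (+ w) ⟩
  (+ 1 ℤ.+ + n) ℤ.- + 2 ℤ.* (+ w ℤ.+ + (if o then 1 else 0))
    ≡⟨ cong (λ s → + suc n ℤ.- s) (ℤₚ.pos-* 2 (level false k z)) ⟨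
  + suc n ℤ.- + (2 * level false k z)     ∎
  where
  open ≡-Reasoning
  w : ℕ
  w = weight z
  o : Bool
  o = oddAfter k z
  identity : ∀ o n w → n ℤ.- + 2 ℤ.* w ℤ.+ σ o ≡ (+ 1 ℤ.+ n) ℤ.- + 2 ℤ.* (w ℤ.+ + (if o then 1 else 0))
  identity false = equal
    where
    equal : ∀ n w → n ℤ.- + 2 ℤ.* w ℤ.+ + 1 ≡ (+ 1 ℤ.+ n) ℤ.- + 2 ℤ.* (w ℤ.+ + 0)
    equal = solve-∀
  identity true = equal
    where
    equal : ∀ n w → n ℤ.- + 2 ℤ.* w ℤ.+ ℤ.- + 1 ≡ (+ 1 ℤ.+ n) ℤ.- + 2 ℤ.* (w ℤ.+ + 1)
    equal = solve-∀

weight-≤ : ∀ {n} (z : Vec Bool n) → weight z ≤ n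
weight-≤ []          = z≤n
weight-≤ (false ∷ z) = ℕₚ.m≤n⇒m≤1+n (weight-≤ z)
weight-≤ (true ∷ z)  = s≤s (weight-≤ z)

level-≤ : ∀ {n} k (z : Vec Bool n) → level false k z ≤ suc n
level-≤ {n} k z with oddAfter k z
... | false = ℕₚ.≤-trans (ℕₚ.≤-reflexive (ℕₚ.+-identityʳ _)) (ℕₚ.m≤n⇒m≤1+n (weight-≤ z))
... | true  = ℕₚ.≤-trans (ℕₚ.≤-reflexive (ℕₚ.+-comm _ 1)) (s≤s (weight-≤ z))

𝟙 : ℕ → ℕ → ℕ
𝟙 m n = if m ≡ᵇ n then 1 else 0

-- Collecting equal linear factors

^P-+ : ∀ p m n → p ^P (m + n) ≋ (p ^P m) *P (p ^P n)
^P-+ p zero    n = ≋-sym (*P-identityˡ (p ^P n))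
^P-+ p (suc m) n = ≋-trans (*P-congˡ p (^P-+ p m n)) (≋-sym (*P-assoc p (p ^P m) (p ^P n)))

prodRange-cong : ∀ lo N {F G : ℕ → Poly} → (∀ i → F i ≋ G i) → prodRange lo N F ≋ prodRange lo N G
prodRange-cong lo zero    e with lo ℕ.≤ᵇ 0
... | true  = e 0
... | false = ≋-refl
prodRange-cong lo (suc N) e with lo ℕ.≤ᵇ suc N
... | true  = *P-cong (prodRange-cong lo N e) (e (suc N))
... | false = *P-cong (prodRange-cong lo N e) ≋-refl

prodRange-*P : ∀ N (F G : ℕ → Poly) →
  prodRange 0 N F *P prodRange 0 N G ≋ prodRange 0 N (λ i → F i *P G i)
prodRange-*P zero    F G = ≋-refl
prodRange-*P (suc N) F G = ≋-trans
  (interchange (prodRange 0 N F) (F (suc N)) (prodRange 0 N G) (G (suc N)))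
  (*-congʳ (prodRange-*P N F G))
  where
  open Algebra.Properties.CommutativeSemigroup
    (CommutativeRing.*-commutativeSemigroup polyRing) using (interchange)

prodRange-one : ∀ N (F : ℕ → Poly) → (∀ i → i ≤ N → F i ≋ oneP) → prodRange 0 N F ≋ oneP
prodRange-one zero    F e = e 0 z≤n
prodRange-one (suc N) F e = ≋-trans
  (*P-cong (prodRange-one N F (λ i i≤N → e i (ℕₚ.m≤n⇒m≤1+n i≤N))) (e (suc N) ℕₚ.≤-refl)) (*P-identityˡ oneP)

≡ᵇ-refl : ∀ n → (n ≡ᵇ n) ≡ true
≡ᵇ-refl zero    = refl
≡ᵇ-refl (suc n) = ≡ᵇ-refl n

<⇒≡ᵇ-false : ∀ {m n} → m < n → (n ≡ᵇ m) ≡ false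
<⇒≡ᵇ-false {zero}  {suc n} _         = refl
<⇒≡ᵇ-false {suc m} {suc n} (s≤s m<n) = <⇒≡ᵇ-false m<n

<⇒≡ᵇ-false′ : ∀ {m n} → m < n → (m ≡ᵇ n) ≡ false
<⇒≡ᵇ-false′ {zero}  {suc n} _         = refl
<⇒≡ᵇ-false′ {suc m} {suc n} (s≤s m<n) = <⇒≡ᵇ-false′ m<n

prodRange-single : ∀ N (g : ℕ → Poly) s → s ≤ N → prodRange 0 N (λ i → g i ^P (𝟙 s i)) ≋ g s
prodRange-single zero    g zero z≤n = *-identityʳ (g 0)
prodRange-single (suc N) g s s≤ with ℕₚ.m≤n⇒m<n∨m≡n s≤
... | inj₁ (s≤s s≤N) rewrite <⇒≡ᵇ-false′ (s≤s s≤N) =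
  ≋-trans (*-identityʳ _) (prodRange-single N g s s≤N)
... | inj₂ refl rewrite ≡ᵇ-refl N = ≋-trans
  (*P-cong
    (prodRange-one N _ λ i i≤N → ≋-reflexive (cong (λ b → g i ^P (if b then 1 else 0)) (<⇒≡ᵇ-false (s≤s i≤N))))
    (*-identityʳ (g (suc N))))
  (*P-identityˡ (g (suc N)))

-- Each factor is spread over all i with exponent 1 at i = `s z` and 0 elsewhere. Exchanging the two
-- products adds the exponents up to the size of each fibre.
foldCube-regroup : ∀ n N (g : ℕ → Poly) (s : Vec Bool n → ℕ) → (∀ z → s z ≤ N) →
  P□.foldCube n (g ∘ s) ≋ prodRange 0 N (λ i → g i ^P #□ n (λ z → 𝟙 (s z) i))
foldCube-regroup n N g s s≤N = ≋-trans
  (P□.foldCube-cong n λ z → ≋-sym (prodRange-single N g (s z) (s≤N z)))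
  (collect n (λ z i → 𝟙 (s z) i))
  where
  -- Arbitrary exponents are needed here, since merging two strings adds their indicators.
  collect : ∀ n (c : Vec Bool n → ℕ → ℕ) →
    P□.foldCube n (λ z → prodRange 0 N (λ i → g i ^P c z i)) ≋
    prodRange 0 N (λ i → g i ^P #□ n (λ z → c z i))
  collect zero    c = ≋-refl
  collect (suc n) c = ≋-trans
    (P□.foldCube-cong n λ z → ≋-trans (prodRange-*P N _ _)
      (prodRange-cong 0 N λ i → ≋-sym (^P-+ (g i) (c (false ∷ z) i) (c (true ∷ z) i))))
    (collect n (λ z i → c (false ∷ z) i + c (true ∷ z) i))

-- Counting the strings of a given level

count : Bool → ℕ → ℕ → ℕ → ℕ
count p k n i = #□ n (λ z → 𝟙 (level p k z) i)

count-skip-zero : ∀ p k n → count p (suc k) (suc n) 0 ≡ count p k n 0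
count-skip-zero p k n = #□-cong n λ z → ℕₚ.+-identityʳ _

-- A leading bit before the block adds itself to the level and leaves the parity of the block alone.
-- This is the recursion matched by `binShift-pascal`.
count-skip-suc : ∀ p k n i → count p (suc k) (suc n) (suc i) ≡ count p k n (suc i) + count p k n i
count-skip-suc p k n i = #□-+ n _ _

not-xor : ∀ p o → p xor not o ≡ not p xor o
not-xor false o     = refl
not-xor true  false = refl
not-xor true  true  = refl

count-flip-zero : ∀ p n → count p 0 (suc n) 0 ≡ count p 0 n 0
count-flip-zero p n = #□-cong n λ z → ℕₚ.+-identityʳ _

count-flip-suc : ∀ p n i → count p 0 (suc n) (suc i) ≡ count p 0 n (suc i) + count (not p) 0 n i
count-flip-suc p n i = trans (#□-+ n _ _) (cong (λ c → count p 0 n (suc i) + c)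
  (#□-cong n λ z → cong (λ b → 𝟙 (weight z + (if b then 1 else 0)) i) (not-xor p (oddAfter 0 z))))

isOdd : ℕ → Bool
isOdd zero    = false
isOdd (suc n) = not (isOdd n)

-- With the parity bit appended, the block becomes a string of length n + 1 and prescribed parity.
count-block : ∀ p n i → count p 0 n i ≡ (if p xor isOdd i then 0 else suc n C i)
count-block false zero zero          = refl
count-block true  zero zero          = refl
count-block false zero (suc zero)    = refl
count-block true  zero (suc zero)    = refl
count-block false zero (suc (suc i)) with isOdd i
... | false = refl
... | true  = refl
count-block true  zero (suc (suc i)) with isOdd i
... | false = refl
... | true  = refl
count-block p (suc n) zero = trans (count-flip-zero p n) (trans (count-block p n zero) (bottom p))
  where
  bottom : ∀ p → (if p xor false then 0 else suc n C 0) ≡ (if p xor false then 0 else suc (suc n) C 0)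
  bottom false = refl
  bottom true  = refl
count-block p (suc n) (suc i) = trans (count-flip-suc p n i)
  (trans (cong₂ _+_ (count-block p n (suc i)) (count-block (not p) n i)) (pascal p (isOdd i)))
  where
  pascal : ∀ p o → (if p xor not o then 0 else suc n C suc i) + (if not p xor o then 0 else suc n C i) ≡
    (if p xor not o then 0 else suc (suc n) C suc i)
  pascal false false = refl
  pascal true  true  = refl
  pascal false true  = trans (ℕₚ.+-comm (suc n C suc i) _) (nCk+nC[k+1]≡[n+1]C[k+1] (suc n) i)
  pascal true  false = trans (ℕₚ.+-comm (suc n C suc i) _) (nCk+nC[k+1]≡[n+1]C[k+1] (suc n) i)

-- The level counts as binomial sums

sumRange-cong : ∀ lo N {f g : ℕ → ℕ} → (∀ i → f i ≡ g i) → sumRange lo N f ≡ sumRange lo N g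
sumRange-cong lo zero    e with lo ℕ.≤ᵇ 0
... | true  = e 0
... | false = refl
sumRange-cong lo (suc N) e with lo ℕ.≤ᵇ suc N
... | true  = cong₂ _+_ (sumRange-cong lo N e) (e (suc N))
... | false = cong₂ _+_ (sumRange-cong lo N e) refl

sumRange-+ : ∀ N (f g : ℕ → ℕ) → sumRange 0 N (λ i → f i + g i) ≡ sumRange 0 N f + sumRange 0 N g
sumRange-+ zero    f g = refl
sumRange-+ (suc N) f g = trans (cong (λ s → s + (f (suc N) + g (suc N))) (sumRange-+ N f g))
  (interchange (sumRange 0 N f) (sumRange 0 N g) (f (suc N)) (g (suc N)))
  where
  open Algebra.Properties.CommutativeSemigroup ℕₚ.+-commutativeSemigroup using (interchange)

sumRange-first : ∀ N (f : ℕ → ℕ) → sumRange 0 (suc N) f ≡ f 0 + sumRange 0 N (f ∘ suc)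
sumRange-first zero    f = refl
sumRange-first (suc N) f = trans (cong (λ s → s + f (suc (suc N))) (sumRange-first N f)) (ℕₚ.+-assoc (f 0) _ _)

sumRange-zero : ∀ N {f : ℕ → ℕ} → (∀ i → f i ≡ 0) → sumRange 0 N f ≡ 0
sumRange-zero zero    e = e 0
sumRange-zero (suc N) e = cong₂ _+_ (sumRange-zero N e) (e (suc N))

-- The coefficient C(a, i - l), with no truncation of the subtraction.
binShift : ℕ → ℕ → ℕ → ℕ
binShift a i       zero    = a C i
binShift a zero    (suc l) = 0
binShift a (suc i) (suc l) = binShift a i l

binZ-shift : ∀ a i l → binZ a (+ i ℤ.- + l) ≡ binShift a i l
binZ-shift a i       zero    = cong (a C_) (ℕₚ.+-identityʳ i)
binZ-shift a zero    (suc l) = refl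
binZ-shift a (suc i) (suc l) = trans
  (cong (binZ a) (trans (ℤₚ.m-n≡m⊖n (suc i) (suc l)) (trans (ℤₚ.[1+m]⊖[1+n]≡m⊖n i l) (sym (ℤₚ.m-n≡m⊖n i l)))))
  (binZ-shift a i l)

-- At l = i + 1 this reads 1 = 1 + 0; truncated subtraction would turn it into 1 = 1 + 1.
binShift-pascal : ∀ a i l → binShift (suc a) (suc i) l ≡ binShift a (suc i) l + binShift a i l
binShift-pascal a i       zero          = trans (sym (nCk+nC[k+1]≡[n+1]C[k+1] a i)) (ℕₚ.+-comm (a C i) _)
binShift-pascal a zero    (suc zero)    = refl
binShift-pascal a zero    (suc (suc l)) = refl
binShift-pascal a (suc i) (suc l)       = binShift-pascal a i l

binShift-bottom : ∀ a l → binShift (suc a) 0 l ≡ binShift a 0 l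
binShift-bottom a zero    = refl
binShift-bottom a (suc l) = refl

binShift-large : ∀ a i l → l + a < i → binShift a i l ≡ 0
binShift-large a i       zero    a<i     = k>n⇒nCk≡0 a<i
binShift-large a zero    (suc l) ()
binShift-large a (suc i) (suc l) (s≤s h) = binShift-large a i l h

-- `binShift 0 i l` is 1 for l = i and 0 otherwise, so the sum selects `g i` when i is even. The
-- bound may exceed 2J by one because both sides are 0 at that odd value. The form `j * 2` makes
-- `suc j * 2` compute to two successors.
sumRange-even : ∀ J i (g : ℕ → ℕ) → i ≤ suc (2 * J) →
  sumRange 0 J (λ j → g (j * 2) * binShift 0 i (j * 2)) ≡ (if isOdd i then 0 else g i)
sumRange-even zero    zero          g _ = ℕₚ.*-identityʳ (g 0)
sumRange-even zero    (suc zero)    g _ = ℕₚ.*-zeroʳ (g 0)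
sumRange-even zero    (suc (suc i)) g (s≤s ())
sumRange-even (suc J) zero          g _ = trans (sumRange-first J _)
  (trans (cong₂ _+_ (ℕₚ.*-identityʳ (g 0)) (sumRange-zero J λ j → ℕₚ.*-zeroʳ (g (suc j * 2)))) (ℕₚ.+-identityʳ _))
sumRange-even (suc J) (suc zero)    g _ = trans (sumRange-first J _)
  (cong₂ _+_ (ℕₚ.*-zeroʳ (g 0)) (sumRange-zero J λ j → ℕₚ.*-zeroʳ (g (suc j * 2))))
sumRange-even (suc J) (suc (suc i)) g h = trans (sumRange-first J _)
  (trans (cong₂ _+_ (ℕₚ.*-zeroʳ (g 0)) (sumRange-even J i (λ l → g (suc (suc l))) bound)) (parity (isOdd i)))
  where
  bound : i ≤ suc (2 * J)
  bound = ℕₚ.≤-pred (ℕₚ.≤-pred (ℕₚ.≤-trans h (ℕₚ.≤-reflexive (cong suc (ℕₚ.*-suc 2 J)))))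
  parity : ∀ b → (if b then 0 else g (suc (suc i))) ≡ (if not (not b) then 0 else g (suc (suc i)))
  parity false = refl
  parity true  = refl

-- The range `J` is separate from the string length k + m, which varies in the induction on k while
-- the range must stay fixed. Here m is the size of the block, and `suc m` includes the parity bit.
multiplicity : ℕ → ℕ → ℕ → ℕ → ℕ
multiplicity J k m i = sumRange 0 J (λ j → (suc m C (2 * j)) * binShift k i (2 * j))

-- For k = 0 only the block remains, and only the even levels are attained. Each further leading bit
-- acts on both sides by Pascal's rule in k.
count-multiplicity : ∀ J k m i → i ≤ suc (2 * J) → count false k (k + m) i ≡ multiplicity J k m i
count-multiplicity J zero m i h = trans (count-block false m i)
  (trans (sym (sumRange-even J i (suc m C_) h))
    (sumRange-cong 0 J λ j → cong (λ l → (suc m C l) * binShift 0 i l) (ℕₚ.*-comm j 2)))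
count-multiplicity J (suc k) m zero h = trans (count-skip-zero false k (k + m))
  (trans (count-multiplicity J k m zero h)
    (sumRange-cong 0 J λ j → cong (λ b → (suc m C (2 * j)) * b) (sym (binShift-bottom k (2 * j)))))
count-multiplicity J (suc k) m (suc i) h = trans (count-skip-suc false k (k + m) i)
  (trans (cong₂ _+_ (count-multiplicity J k m (suc i) h) (count-multiplicity J k m i (ℕₚ.≤-trans (ℕₚ.n≤1+n i) h)))
  (trans (sym (sumRange-+ J _ _))
    (sumRange-cong 0 J λ j → trans (sym (ℕₚ.*-distribˡ-+ (suc m C (2 * j)) _ _))
      (cong (λ b → (suc m C (2 * j)) * b) (sym (binShift-pascal k i (2 * j)))))))

count-0 : ∀ k m → count false k (k + m) 0 ≡ 1
count-0 zero    m = count-block false m 0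
count-0 (suc k) m = trans (count-skip-zero false k (k + m)) (count-0 k m)

count-1 : ∀ k m → count false k (k + m) 1 ≡ k
count-1 zero    m = count-block false m 1
count-1 (suc k) m = trans (count-skip-suc false k (k + m) 0)
  (trans (cong₂ _+_ (count-1 k m) (count-0 k m)) (ℕₚ.+-comm k 1))

block-size : ∀ k m → (k + suc m) ∸ suc k ≡ m
block-size k m = trans (cong (_∸ suc k) (ℕₚ.+-suc k m)) (ℕₚ.m+n∸m≡n k m)

bound-2n : ∀ {i n} → i ≤ suc n → i ≤ suc (2 * n)
bound-2n h = ℕₚ.≤-trans h (s≤s (ℕₚ.m≤m+n _ _))

-- The eigenvalue n - 2t - 1 is n + 1 - 2s for s = t + 1.
gamma-count : ∀ k m t → t ≤ k + suc m → gamma (k + suc m) (suc k) t ≡ count false k (k + suc m) (suc t)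
gamma-count k m t t≤n = trans
  (sumRange-cong 0 n λ j → cong₂ (λ a b → (a C (2 * j)) * b)
    (trans (cong (_+ 2) (block-size k m)) (ℕₚ.+-comm m 2))
    (trans (cong (λ s → binZ k (+ s ℤ.- + (2 * j))) (ℕₚ.+-comm t 1)) (binZ-shift k (suc t) (2 * j))))
  (sym (count-multiplicity n k (suc m) (suc t) (bound-2n (s≤s t≤n))))
  where
  n : ℕ
  n = k + suc m

sumRange-from-1 : ∀ N (f : ℕ → ℕ) → f 0 ≡ 0 → sumRange 0 N f ≡ sumRange 1 N f
sumRange-from-1 zero    f e = e
sumRange-from-1 (suc N) f e = cong (λ s → s + f (suc N)) (sumRange-from-1 N f e)

sumRange-1-cong : ∀ N {f g : ℕ → ℕ} → (∀ i → f (suc i) ≡ g (suc i)) → sumRange 1 N f ≡ sumRange 1 N g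
sumRange-1-cong zero    e = refl
sumRange-1-cong (suc N) e = cong₂ _+_ (sumRange-1-cong N e) (e N)

-- The two sides differ by C(m, l + 1) C(k, k + m - l); the first factor vanishes for l ≥ m and the
-- second for l < m.
top-term : ∀ k m l →
  (m C l) * binShift k (suc (k + m)) (suc l) ≡ (suc m C suc l) * binShift k (suc (k + m)) (suc l)
top-term k m l with ℕₚ.<-≤-connex l m
... | inj₁ l<m rewrite binShift-large k (k + m) l
    (ℕₚ.≤-trans (ℕₚ.≤-reflexive (sym (ℕₚ.+-comm k (suc l)))) (ℕₚ.+-monoʳ-≤ k l<m)) =
  trans (ℕₚ.*-zeroʳ (m C l)) (sym (ℕₚ.*-zeroʳ (suc m C suc l)))
... | inj₂ m≤l = cong (_* binShift k (k + m) l)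
  (trans (sym (ℕₚ.+-identityʳ _)) (trans
    (cong (λ c → (m C l) + c) (sym (k>n⇒nCk≡0 (s≤s m≤l)))) (nCk+nC[k+1]≡[n+1]C[k+1] m l)))

gammaN-count : ∀ k m → gammaN (k + suc m) (suc k) ≡ count false k (k + suc m) (suc (k + suc m))
gammaN-count k m = trans (sumRange-1-cong n term) (trans (sym (sumRange-from-1 n _ first))
  (sym (count-multiplicity n k (suc m) (suc n) (bound-2n ℕₚ.≤-refl))))
  where
  n : ℕ
  n = k + suc m
  -- The sum for γ_n starts at j = 1; the term j = 0 would choose n + 1 of only k coordinates.
  first : (suc (suc m) C 0) * binShift k (suc n) 0 ≡ 0
  first = trans (cong (λ b → (suc (suc m) C 0) * b) (k>n⇒nCk≡0 (s≤s (ℕₚ.m≤m+n k (suc m)))))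
    (ℕₚ.*-zeroʳ (suc (suc m) C 0))
  term : ∀ i → ((n ∸ suc k + 1) C (2 * suc i ∸ 1)) * binZ k (+ (n + 1) ℤ.- + (2 * suc i)) ≡
    (suc (suc m) C (2 * suc i)) * binShift k (suc n) (2 * suc i)
  term i = trans
    (cong₂ (λ a b → (a C (2 * suc i ∸ 1)) * b)
      (trans (cong (_+ 1) (block-size k m)) (ℕₚ.+-comm m 1))
      (trans (cong (λ s → binZ k (+ s ℤ.- + (2 * suc i))) (ℕₚ.+-comm n 1)) (binZ-shift k (suc n) (2 * suc i))))
    (top-term k (suc m) (2 * suc i ∸ 1))

-- Assembling the spectrum

prodRange-first-two : ∀ N (F : ℕ → Poly) →
  prodRange 0 (suc N) F ≋ F 0 *P F 1 *P prodRange 1 N (F ∘ suc)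
prodRange-first-two zero    F = ≋-sym (*-identityʳ (F 0 *P F 1))
prodRange-first-two (suc N) F = ≋-trans (*-congʳ (prodRange-first-two N F))
  (*P-assoc (F 0 *P F 1) (prodRange 1 N (F ∘ suc)) (F (suc (suc N))))

prodRange-1-cong : ∀ N {F G : ℕ → Poly} → (∀ i → i ≤ N → F i ≋ G i) → prodRange 1 N F ≋ prodRange 1 N G
prodRange-1-cong zero    e = ≋-refl
prodRange-1-cong (suc N) e = *P-cong (prodRange-1-cong N λ i i≤N → e i (ℕₚ.m≤n⇒m≤1+n i≤N)) (e (suc N) ℕₚ.≤-refl)

level-1 : ∀ n → + suc n ℤ.- + 2 ≡ + n ℤ.- + 1
level-1 n = identity (+ n)
  where
  identity : ∀ n → (+ 1 ℤ.+ n) ℤ.- + 2 ≡ n ℤ.- + 1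
  identity = solve-∀

level-suc : ∀ n t → + suc n ℤ.- + (2 * suc t) ≡ + n ℤ.- + (2 * t) ℤ.- + 1
level-suc n t = trans (cong (λ s → + suc n ℤ.- s) (ℤₚ.pos-* 2 (suc t)))
  (trans (identity (+ n) (+ t)) (cong (λ s → + n ℤ.- s ℤ.- + 1) (sym (ℤₚ.pos-* 2 t))))
  where
  identity : ∀ n t → (+ 1 ℤ.+ n) ℤ.- + 2 ℤ.* (+ 1 ℤ.+ t) ≡ n ℤ.- + 2 ℤ.* t ℤ.- + 1
  identity = solve-∀

level-top : ∀ n → + suc n ℤ.- + (2 * suc n) ≡ ℤ.- + (n + 1)
level-top n = trans (cong (λ s → + suc n ℤ.- s) (ℤₚ.pos-* 2 (suc n)))
  (trans (identity (+ suc n)) (cong (λ s → ℤ.- + s) (ℕₚ.+-comm 1 n)))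
  where
  identity : ∀ a → a ℤ.- + 2 ℤ.* a ≡ ℤ.- a
  identity = solve-∀

charPoly-spectrumPoly : ∀ k m →
  charPoly (adjMatrix (k + suc (suc m)) (suc k)) ≋ spectrumPoly (k + suc (suc m)) (suc k)
charPoly-spectrumPoly k m = ≋-trans (charPoly-adjMatrix k m)
  (≋-trans (P□.foldCube-cong n λ z → ≋-reflexive (cong linP (eigenvalue-level k z)))
  (≋-trans (foldCube-regroup n (suc n) (levelPoly n) (level false k) (level-≤ k))
  -- The top level n + 1 splits off by computation; n is then written as a successor so that levels
  -- 0 and 1 can be taken off the bottom.
  (≋-trans (≋-reflexive (cong (λ N → prodRange 0 N F *P F (suc n)) n≡))
  (≋-trans (*-congʳ (prodRange-first-two (n ∸ 1) F))
    (*P-cong (*P-cong (*P-cong f0 f1) (prodRange-1-cong (n ∸ 1) middle)) top)))))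
  where
  n : ℕ
  n = k + suc (suc m)
  F : ℕ → Poly
  F i = levelPoly n i ^P count false k n i
  n≡ : n ≡ suc (n ∸ 1)
  n≡ = trans (ℕₚ.+-suc k (suc m)) (cong (λ s → suc (s ∸ 1)) (sym (ℕₚ.+-suc k (suc m))))
  f0 : F 0 ≋ linP (+ (n + 1))
  f0 = ≋-trans (≋-reflexive (cong (levelPoly n 0 ^P_) (count-0 k (suc (suc m)))))
    (≋-trans (*-identityʳ (levelPoly n 0))
      (≋-reflexive (cong linP (trans (ℤₚ.+-identityʳ (+ suc n)) (cong +_ (ℕₚ.+-comm 1 n))))))
  f1 : F 1 ≋ linP (+ n ℤ.- + 1) ^P k
  f1 = ≋-reflexive (cong₂ (λ a c → linP a ^P c) (level-1 n) (count-1 k (suc (suc m))))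
  middle : ∀ t → t ≤ n ∸ 1 → F (suc t) ≋ linP (+ n ℤ.- + (2 * t) ℤ.- + 1) ^P gamma n (suc k) t
  middle t t≤ = ≋-reflexive (cong₂ (λ a c → linP a ^P c) (level-suc n t)
    (sym (gamma-count k (suc m) t (ℕₚ.≤-trans t≤ (ℕₚ.m∸n≤m n 1)))))
  top : F (suc n) ≋ linP (ℤ.- + (n + 1)) ^P gammaN n (suc k)
  top = ≋-reflexive (cong₂ (λ a c → linP a ^P c) (level-top n) (sym (gammaN-count k (suc m))))

theorem2 : (n k : ℕ) → 2 ≤ n → 1 ≤ k → k ≤ n ∸ 1 →
    charPoly (adjMatrix n k) ≈P spectrumPoly n k
-- After the patterns the string length is n + 2 and the block starts after k coordinates, so its
-- size is (n - k) + 2.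
theorem2 (suc (suc n)) (suc k) _ _ (s≤s k≤n) =
  subst (λ n → charPoly (adjMatrix n (suc k)) ≈P spectrumPoly n (suc k)) split
    (_≋_.coeff-≡ (charPoly-spectrumPoly k (n ∸ k)))
  where
  split : k + suc (suc (n ∸ k)) ≡ suc (suc n)
  split = trans (ℕₚ.+-suc k _) (cong suc (trans (ℕₚ.+-suc k _) (cong suc (ℕₚ.m+[n∸m]≡n k≤n))))
theorem2 (suc zero) _ (s≤s ())
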